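{- Let $H$ be the graph on vertex set $\{0,1,2,3\}$ whose edges are one red edge $\{0,1\}$ and two blue edges $\{0,2\}$ and $\{0,3\}$. Let $n\ge 4$ be an integer. (1) If $n$ is congruent to $1$, $2$ or $4$ modulo $6$, then $\Lambda_H(n)=n\,\pi_3(2n-3)/2$, and a graph $G$ of order $n$ satisfies $\Lambda_H(G)=\Lambda_H(n)$ if and only if $G$ is $\lfloor n/3\rfloor$-regular. (2) If $n=6k$ for an integer $k$, then $\Lambda_H(n)=n\,\pi_3(2n-3)/2-3k(4k-1)$, and a graph $G$ of order $n$ satisfies $\Lambda_H(G)=\Lambda_H(n)$ if and only if every vertex of $G$ has degree $2k-1$ or $2k$. (3) If $n=6k+3$ for an integer $k$, then $\Lambda_H(n)=n\,\pi_3(2n-3)/2-(6k+3)(4k+1)/2$, and a graph $G$ of order $n$ satisfies $\Lambda_H(G)=\Lambda_H(n)$ if and only if every vertex of $G$ has degree $2k$ or $2k+1$. (4) If $n=6k+5$ for an integer $k$, then $\Lambda_H(n)=n\,\pi_3(2n-3)/2-4k-2$, and a graph $G$ of order $n$ satisfies $\Lambda_H(G)=\Lambda_H(n)$ if and only if $G$ has $n-1$ vertices of degree $2k+1$ and one vertex of degree $2k+2$.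
   Context: All graphs are finite and simple; the order of a graph is its number of vertices. For a graph $H$ whose edges are coloured red or blue and an uncoloured graph $G$, an embedding of $H$ into $G$ is an injection $V(H)\to V(G)$ that maps red edges of $H$ to edges of $G$ and blue edges of $H$ to non-edges of $G$ (pairs of distinct non-adjacent vertices). $\Lambda_H(G)$ is the number of embeddings of $H$ into $G$, and $\Lambda_H(n)$ is the maximum of $\Lambda_H(G)$ over all graphs $G$ of order $n$. For non-negative integers $N$, $\pi_3(N)$ denotes the maximum product of three non-negative integers that sum to $N$, i.e. $\pi_3(N)=\lfloor N/3\rfloor\lfloor (N+1)/3\rfloor\lfloor (N+2)/3\rfloor$. -}

module Defs where

open import Data.Bool.Base using (Bool; true; false; T)
open import Data.Bool.Properties using (T?)
open import Data.Fin.Base using (Fin)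
open import Data.Fin.Patterns using (0F; 1F; 2F; 3F)
open import Data.Fin.Properties using (all?; _≟_)
open import Data.List.Base using (List; []; _∷_; [_]; map; filter; length; allFin; upTo; cartesianProductWith)
open import Data.List.Extrema.Nat using (max; xs≤max; argmax-sel)
open import Data.List.Membership.Propositional using (_∈_)
open import Data.List.Membership.Propositional.Properties
  using (∈-cartesianProductWith⁺; ∈-map⁺; ∈-map⁻; ∈-filter⁺; ∈-filter⁻; ∈-upTo⁺)
open import Data.List.Properties using (filter-≐)
open import Data.List.Relation.Unary.All as All using ()
open import Data.List.Relation.Unary.Any using (here; there)
open import Data.Maybe.Base using (Maybe; just; nothing)
import Data.Maybe.Properties as Maybe
open import Data.Nat.Base using (ℕ; zero; suc; _+_; _*_; _≤_; z≤n; s≤s)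
import Data.Nat.Properties as ℕ
open import Data.Product.Base using (Σ-syntax; ∃; _×_; _,_; proj₁; proj₂)
open import Data.Sum.Base using (_⊎_; inj₁; inj₂)
open import Data.Vec.Base as Vec using (Vec; []; _∷_; lookup; tabulate; sum)
open import Data.Vec.Properties using (lookup∘tabulate)
open import Function.Base using (id; _∘_)
open import Function.Definitions using (Injective)
open import Level using (0ℓ)
open import Relation.Binary.Core using (Rel)
open import Relation.Binary.Definitions using (Decidable; DecidableEquality; Symmetric; Irreflexive)
open import Relation.Binary.PropositionalEquality
  using (_≡_; _≢_; refl; sym; trans; cong; subst)
open import Relation.Nullary.Decidable
  using (Dec; yes; no; ⌊_⌋; map′; ¬?; _×-dec_; _⊎-dec_; _→-dec_; from-yes; toWitness; fromWitness)
open import Relation.Nullary.Negation using (¬_; contradiction)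

record Graph (n : ℕ) : Set₁ where
  field
    Adj         : Rel (Fin n) 0ℓ
    adj?        : Decidable Adj
    symmetric   : Symmetric Adj
    irreflexive : Irreflexive _≡_ Adj

open Graph public

degree : ∀ {n} → Graph n → Fin n → ℕ
degree {n} G v = length (filter (adj? G v) (allFin n))

IsRegular : ∀ {n} → Graph n → ℕ → Set
IsRegular G d = ∀ v → degree G v ≡ d

#degree≡ : ∀ {n} → Graph n → ℕ → ℕ
#degree≡ {n} G d = length (filter (λ v → degree G v ℕ.≟ d) (allFin n))

data Colour : Set where
  red blue : Colour

_≟ᶜ_ : DecidableEquality Colour
red  ≟ᶜ red  = yes refl
red  ≟ᶜ blue = no λ ()
blue ≟ᶜ red  = no λ ()
blue ≟ᶜ blue = yes refl

-- 'nothing' marks a pair that is not an edge.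
record ColouredGraph (h : ℕ) : Set where
  field
    colour   : Fin h → Fin h → Maybe Colour
    col-sym  : ∀ i j → colour i j ≡ colour j i
    loopless : ∀ i → colour i i ≡ nothing

open ColouredGraph public

_≟ᵐ_ : DecidableEquality (Maybe Colour)
_≟ᵐ_ = Maybe.≡-dec _≟ᶜ_

H : ColouredGraph 4
H = record
  { colour   = c
  ; col-sym  = from-yes (all? λ i → all? λ j → c i j ≟ᵐ c j i)
  ; loopless = from-yes (all? λ i → c i i ≟ᵐ nothing)
  }
  where
  c : Fin 4 → Fin 4 → Maybe Colour
  c 0F 1F = just red
  c 1F 0F = just red
  c 0F 2F = just blue
  c 2F 0F = just blue
  c 0F 3F = just blue
  c 3F 0F = just blue
  c _  _  = nothing

-- A map V(K) → V(G) is represented by the vector of its values, so that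
-- distinct list entries below are distinct maps.  Injectivity makes the
-- image of a blue edge a pair of distinct vertices.
IsEmbedding : ∀ {h n} → ColouredGraph h → Graph n → Vec (Fin n) h → Set
IsEmbedding K G f =
    Injective _≡_ _≡_ (lookup f)
  × (∀ i j → colour K i j ≡ just red  → Adj G (lookup f i) (lookup f j))
  × (∀ i j → colour K i j ≡ just blue → ¬ Adj G (lookup f i) (lookup f j))

isEmbedding? : ∀ {h n} (K : ColouredGraph h) (G : Graph n) f → Dec (IsEmbedding K G f)
isEmbedding? K G f =
        map′ (λ inj {i} {j} → inj i j) (λ inj i j → inj {i} {j})
          (all? λ i → all? λ j → (lookup f i ≟ lookup f j) →-dec (i ≟ j))
  ×-dec (all? λ i → all? λ j →
          (colour K i j ≟ᵐ just red) →-dec adj? G (lookup f i) (lookup f j))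
  ×-dec (all? λ i → all? λ j →
          (colour K i j ≟ᵐ just blue) →-dec ¬? (adj? G (lookup f i) (lookup f j)))

-- All vectors of length k with entries from xs, each once if xs has no
-- repetitions.
tuples : ∀ {A : Set} (k : ℕ) → List A → List (Vec A k)
tuples zero    xs = [ [] ]
tuples (suc k) xs = cartesianProductWith _∷_ xs (tuples k xs)

Λ : ∀ {h n} → ColouredGraph h → Graph n → ℕ
Λ {h} {n} K G = length (filter (isEmbedding? K G) (tuples h (allFin n)))

Matrix : ℕ → Set
Matrix n = Vec (Vec Bool n) n

-- Every matrix is read as a graph by symmetrising it and ignoring its
-- diagonal; up to agreement of adjacency this yields every graph (see
-- Λmax-isMaximum).
fromMatrix : ∀ {n} → Matrix n → Graph n
fromMatrix M = record
  { Adj         = λ i j → i ≢ j × (T (M ⟨ i , j ⟩) ⊎ T (M ⟨ j , i ⟩))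
  ; adj?        = λ i j → ¬? (i ≟ j) ×-dec (T? (M ⟨ i , j ⟩) ⊎-dec T? (M ⟨ j , i ⟩))
  ; symmetric   = λ { (i≢j , inj₁ t) → i≢j ∘ sym , inj₂ t
                    ; (i≢j , inj₂ t) → i≢j ∘ sym , inj₁ t }
  ; irreflexive = λ i≡j (i≢j , _) → i≢j i≡j
  }
  where
  _⟨_,_⟩ : ∀ {n} → Matrix n → Fin n → Fin n → Bool
  M ⟨ i , j ⟩ = lookup (lookup M i) j

matrices : ∀ n → List (Matrix n)
matrices n = tuples n (tuples n (false ∷ true ∷ []))

Λmax : ∀ {h} → ColouredGraph h → ℕ → ℕ
Λmax K n = max 0 (map (Λ K ∘ fromMatrix) (matrices n))

product : ∀ {k} → Vec ℕ k → ℕ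
product = Vec.foldr′ _*_ 1

π₃ : ℕ → ℕ
π₃ N = max 0 (map product (filter (λ v → sum v ℕ.≟ N) (tuples 3 (upTo (suc N)))))

record IsMaximum {a} {A : Set a} (f : A → ℕ) (m : ℕ) : Set a where
  field
    attained   : ∃ λ x → f x ≡ m
    upperBound : ∀ x → f x ≤ m

max-∈ : ∀ {x} {xs : List ℕ} → x ∈ xs → max 0 xs ∈ xs
max-∈ {x} {xs} x∈xs with argmax-sel id 0 xs
... | inj₂ m∈xs = m∈xs
... | inj₁ m≡0  = subst (_∈ xs) x≡m x∈xs
  where
  x≡m : x ≡ max 0 xs
  x≡m = trans (ℕ.n≤0⇒n≡0 (subst (x ≤_) m≡0 (All.lookup (xs≤max 0 xs) x∈xs))) (sym m≡0)

≤-max : ∀ {x} {xs : List ℕ} → x ∈ xs → x ≤ max 0 xs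
≤-max {xs = xs} = All.lookup (xs≤max 0 xs)

∈-tuples : ∀ {A : Set} {k} {xs : List A} (v : Vec A k) →
           (∀ i → lookup v i ∈ xs) → v ∈ tuples k xs
∈-tuples []      v∈ = here refl
∈-tuples (x ∷ v) v∈ = ∈-cartesianProductWith⁺ _∷_ (v∈ Fin.zero) (∈-tuples v (v∈ ∘ Fin.suc))

∈-matrices : ∀ {n} (M : Matrix n) → M ∈ matrices n
∈-matrices M = ∈-tuples M λ i → ∈-tuples (lookup M i) λ j → ∈-bools (lookup (lookup M i) j)
  where
  ∈-bools : ∀ b → b ∈ false ∷ true ∷ []
  ∈-bools false = here refl
  ∈-bools true  = there (here refl)

toMatrix : ∀ {n} → Graph n → Matrix n
toMatrix G = tabulate λ i → tabulate λ j → ⌊ adj? G i j ⌋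

lookup-toMatrix : ∀ {n} (G : Graph n) i j → lookup (lookup (toMatrix G) i) j ≡ ⌊ adj? G i j ⌋
lookup-toMatrix G i j =
  trans (cong (λ r → lookup r j) (lookup∘tabulate (λ i → tabulate λ j → ⌊ adj? G i j ⌋) i))
        (lookup∘tabulate (λ j → ⌊ adj? G i j ⌋) j)

infix 4 _≈_

_≈_ : ∀ {n} → Graph n → Graph n → Set
G ≈ G′ = ∀ i j → (Adj G i j → Adj G′ i j) × (Adj G′ i j → Adj G i j)

fromMatrix-surjective : ∀ {n} (G : Graph n) → ∃ λ M → G ≈ fromMatrix M
fromMatrix-surjective G = toMatrix G , λ i j →
    (λ a → (λ i≡j → irreflexive G i≡j a) ,
           inj₁ (subst T (sym (lookup-toMatrix G i j)) (fromWitness a)))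
  , λ { (_ , inj₁ t) → toWitness (subst T (lookup-toMatrix G i j) t)
      ; (_ , inj₂ t) → symmetric G (toWitness (subst T (lookup-toMatrix G j i) t)) }

Λ-cong : ∀ {h n} (K : ColouredGraph h) {G G′ : Graph n} → G ≈ G′ → Λ K G ≡ Λ K G′
Λ-cong {h} {n} K {G} {G′} G≈G′ = cong length
  (filter-≐ (isEmbedding? K G) (isEmbedding? K G′)
    ( (λ (inj , r , b) → (λ {i} {j} → inj {i} {j})
                       , (λ i j e → proj₁ (G≈G′ _ _) (r i j e))
                       , (λ i j e → b i j e ∘ proj₂ (G≈G′ _ _)))
    , (λ (inj , r , b) → (λ {i} {j} → inj {i} {j})
                       , (λ i j e → proj₂ (G≈G′ _ _) (r i j e))
                       , (λ i j e → b i j e ∘ proj₁ (G≈G′ _ _))) )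
    (tuples h (allFin n)))

Λmax-isMaximum : ∀ {h} (K : ColouredGraph h) n → IsMaximum {A = Graph n} (Λ K) (Λmax K n)
Λmax-isMaximum K n = record
  { attained   = let (M , _ , eq) = ∈-map⁻ (Λ K ∘ fromMatrix)
                       (max-∈ (∈-map⁺ (Λ K ∘ fromMatrix) (∈-matrices M₀)))
                 in fromMatrix M , sym eq
  ; upperBound = λ G → let (M , G≈M) = fromMatrix-surjective G in
      subst (_≤ Λmax K n) (sym (Λ-cong K {G} {fromMatrix M} G≈M))
        (≤-max (∈-map⁺ (Λ K ∘ fromMatrix) (∈-matrices M)))
  }
  where
  M₀ : Matrix n
  M₀ = Vec.replicate n (Vec.replicate n false)

π₃-isMaximum : ∀ N → IsMaximum {A = Σ[ v ∈ Vec ℕ 3 ] sum v ≡ N} (product ∘ proj₁) (π₃ N)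
π₃-isMaximum N = record
  { attained   = let (v , v∈ , eq) = ∈-map⁻ product (max-∈ (∈-map⁺ product (∈-triples v₀ v₀-sum)))
                 in (v , proj₂ (∈-filter⁻ sum≟ {xs = tuples 3 (upTo (suc N))} v∈)) , sym eq
  ; upperBound = λ (v , s) → ≤-max (∈-map⁺ product (∈-triples v s))
  }
  where
  sum≟ : (v : Vec ℕ 3) → Dec (sum v ≡ N)
  sum≟ v = sum v ℕ.≟ N

  lookup≤sum : ∀ {k} (v : Vec ℕ k) i → lookup v i ≤ sum v
  lookup≤sum (x ∷ v) Fin.zero    = ℕ.m≤m+n x (sum v)
  lookup≤sum (x ∷ v) (Fin.suc i) = ℕ.≤-trans (lookup≤sum v i) (ℕ.m≤n+m (sum v) x)

  ∈-triples : ∀ v → sum v ≡ N → v ∈ filter sum≟ (tuples 3 (upTo (suc N)))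
  ∈-triples v refl = ∈-filter⁺ sum≟ (∈-tuples v λ i → ∈-upTo⁺ (s≤s (lookup≤sum v i))) refl

  v₀ : Vec ℕ 3
  v₀ = N ∷ 0 ∷ 0 ∷ []

  v₀-sum : sum v₀ ≡ N
  v₀-sum = ℕ.+-identityʳ N

{-# OPTIONS --safe #-}
module Submission where

-- Counting at the centre of H gives Λ_H(G) = Σ_v f(d(v)) with f(d) = d (n − 1 − d) (n − 2 − d), and
-- f(d + 1) − f(d) = (n − 2 − d) (n − 3 − 3d).  Hence f increases up to ⌊n/3⌋ and then decreases until
-- it vanishes at n − 2, strictly except that f(n/3 − 1) = f(n/3) when 3 ∣ n.  2 f(d) is a product of three numbers with
-- sum 2n − 3, which at the peak are as equal as possible unless 3 ∣ n.  For n = 6k + 5 both n and the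
-- peak 2k + 1 are odd, so some vertex misses the peak; the cheapest way is a single vertex of degree
-- 2k + 2.  The bounds are attained by bipartite circulant graphs; for odd n, an additional vertex is
-- joined to both ends of some removed matching edges.

open import Defs
open import Data.Bool.Base using (true; false; if_then_else_)
open import Data.Empty using (⊥)
open import Data.Fin.Base using (Fin; zero; suc; toℕ; splitAt; opposite)
open import Data.Fin.Patterns using (0F; 1F; 2F; 3F)
open import Data.Fin.Properties using (_≟_; toℕ<n; toℕ-injective; opposite-prop)
import Data.Integer as ℤ
import Data.Integer.Properties as ℤ
import Data.Integer.Tactic.RingSolver as ℤ-Solver
open import Data.List.Base using (List; []; _∷_; _++_; map; filter; length; tabulate; allFin; cartesianProductWith)
open import Data.List.Properties using (filter-++; length-++)
open import Data.Nat as ℕ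
  using (ℕ; zero; suc; _+_; _*_; _∸_; _/_; _%_; _≤_; _<_; _≥_; _≤?_; _<?_; z≤n; s≤s; s≤s⁻¹; NonZero; >-nonZero;
         _≤′_; ≤′-refl; ≤′-step)
import Data.Nat.Properties as ℕ
open import Data.Nat.Divisibility using (_∣_; divides; m∣m*n; ∣m+n∣m⇒∣n; ∣1⇒≡1)
open import Data.Nat.DivMod
  using (m≡m%n+[m/n]*n; +-distrib-/-∣ˡ; m<n⇒m/n≡0; m*n/n≡m; [m+n]%n≡m%n; m<n⇒m%n≡m; n%n≡0)
open import Data.Nat.Tactic.RingSolver using (solve-∀)
open import Data.Product using (∃; _×_; _,_; proj₁; proj₂)
import Data.Rational.Base as ℚ
open import Data.Rational using (toℚᵘ; _-_) renaming (_/_ to _÷_)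
import Data.Rational.Properties as ℚ
import Data.Rational.Unnormalised as ℚᵘ
open import Data.Rational.Unnormalised using (mkℚᵘ; *≡*)
import Data.Rational.Unnormalised.Properties as ℚᵘ
open import Data.Sum as Sum using (_⊎_; inj₁; inj₂)
open import Data.Vec.Base using (Vec; []; _∷_; lookup)
open import Data.Vec.Relation.Unary.All using ([]; _∷_)
open import Data.Vec.Relation.Unary.AllPairs using ([]; _∷_)
open import Data.Vec.Relation.Unary.Unique.Propositional.Properties using (lookup-injective)
open import Function.Base using (_∘_; id)
open import Function.Bundles using (_⇔_; mk⇔; Equivalence)
open import Level using (0ℓ)
open import Relation.Binary.Core using (Rel)
open import Relation.Binary.Definitions using (tri<; tri≈; tri>) renaming (Decidable to Decidable₂)
open import Relation.Binary.PropositionalEquality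
import Relation.Binary.Reasoning.Setoid as SetoidReasoning
open import Relation.Nullary using (¬_; Dec; yes; no; does; ¬?; contradiction)
open import Relation.Nullary.Decidable using (_×-dec_; does-⇔)
open import Relation.Unary using (Pred; Decidable)

open import Algebra.Properties.Semiring.Sum ℕ.+-*-semiring
  using (sum-cong-≗; ∑-distrib-+; ∑-comm; *-distribˡ-sum; *-distribʳ-sum)
  renaming (sum to ∑)

-- Counting embeddings

-- A red neighbour of the centre never coincides with a blue one, so the leaves are chosen
-- independently and only the degree of the centre matters: the problem is one about degree
-- sequences. Realising a sequence is the obstacle for odd n, since two equal classes have even
-- order. The additional vertex must leave the other degrees alone: removing a matching edge frees
-- one place at each end, and an edge to the new vertex fills it. Its degree is thus an even number
-- 2c, which yields regular graphs of even degree and, for n = 6k + 5, the degree 2k + 2 next to the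
-- odd peak. There degree 2k + 2 costs exactly 4k + 2, every other degree off the peak costs more,
-- and the handshake lemma forces at least one vertex off the peak. For n = 3 (t + 1) the three
-- factors are 2t, 2t + 1, 2t + 2 instead of three times q = 2t + 1, so each vertex falls short by q
-- / 2; this is the origin of 4k - 1 and 4k + 1. Differences are written as sums with a slack
-- variable, because subtraction in ℕ truncates.

⟦_⟧ : ∀ {p} {P : Set p} → Dec P → ℕ
⟦ P? ⟧ = if does P? then 1 else 0

module _ {p q} {P : Set p} {Q : Set q} (P? : Dec P) (Q? : Dec Q) where

  ⟦⟧-cong : (P → Q) → (Q → P) → ⟦ P? ⟧ ≡ ⟦ Q? ⟧
  ⟦⟧-cong f g = cong (if_then 1 else 0) (does-⇔ (mk⇔ f g) P? Q?)

  ⟦⟧-× : ⟦ P? ×-dec Q? ⟧ ≡ ⟦ P? ⟧ * ⟦ Q? ⟧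
  ⟦⟧-× with does P? | does Q?
  ... | true  | true  = refl
  ... | true  | false = refl
  ... | false | _     = refl

⟦⟧-yes : ∀ {p} {P : Set p} (P? : Dec P) → P → ⟦ P? ⟧ ≡ 1
⟦⟧-yes (yes _) _ = refl
⟦⟧-yes (no ¬p) p = contradiction p ¬p

-- Phrased as a sum to avoid truncated subtraction; it later splits the circulant edges into kept
-- and removed ones.
⟦⟧-∖ : ∀ {p q} {P : Set p} {Q : Set q} (P? : Dec P) (Q? : Dec Q) → (Q → P) →
       ⟦ P? ×-dec ¬? Q? ⟧ + ⟦ Q? ⟧ ≡ ⟦ P? ⟧
⟦⟧-∖ (yes _) (yes _) _   = refl
⟦⟧-∖ (yes _) (no _)  _   = refl
⟦⟧-∖ (no ¬p) (yes q) Q⇒P = contradiction (Q⇒P q) ¬p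
⟦⟧-∖ (no _)  (no _)  _   = refl

∑-const : ∀ n x → ∑ {n} (λ _ → x) ≡ n * x
∑-const zero    x = refl
∑-const (suc n) x = cong (x +_) (∑-const n x)

∑-single : ∀ {n} (f : Fin n → ℕ) v → ∑ (λ u → ⟦ v ≟ u ⟧ * f u) ≡ f v
∑-single {suc n} f zero    = begin
  1 * f zero + ∑ {n} (λ _ → 0)  ≡⟨ cong₂ _+_ (ℕ.*-identityˡ _) (trans (∑-const n 0) (ℕ.*-zeroʳ n)) ⟩
  f zero + 0                    ≡⟨ ℕ.+-identityʳ _ ⟩
  f zero                        ∎
  where open ≡-Reasoning
∑-single {suc n} f (suc v) = ∑-single (f ∘ suc) v

∑∑-* : ∀ {m n} (f : Fin m → ℕ) (g : Fin n → ℕ) → ∑ (λ i → ∑ (λ j → f i * g j)) ≡ ∑ f * ∑ g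
∑∑-* f g = trans (sum-cong-≗ λ i → sym (*-distribˡ-sum (f i) g)) (sym (*-distribʳ-sum (∑ g) f))

module _ {a} {A : Set a} {P : Pred A 0ℓ} (P? : Decidable P) where

  length-filter-tabulate : ∀ {n} (f : Fin n → A) →
    length (filter P? (tabulate f)) ≡ ∑ (λ i → ⟦ P? (f i) ⟧)
  length-filter-tabulate {zero}  f = refl
  length-filter-tabulate {suc n} f with does (P? (f zero))
  ... | true  = cong suc (length-filter-tabulate (f ∘ suc))
  ... | false = length-filter-tabulate (f ∘ suc)

  length-filter-map : ∀ {b} {B : Set b} (g : B → A) xs →
    length (filter P? (map g xs)) ≡ length (filter (P? ∘ g) xs)
  length-filter-map g []       = refl
  length-filter-map g (x ∷ xs) with does (P? (g x))
  ... | true  = cong suc (length-filter-map g xs)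
  ... | false = length-filter-map g xs

-- Trades the outermost coordinate of a list of tuples for a sum over `Fin n`; four applications
-- give the quadruple sum.
length-filter-product : ∀ {n k} {A : Set} {P : Pred (Vec A (suc k)) 0ℓ} (P? : Decidable P)
  (f : Fin n → A) (vs : List (Vec A k)) →
  length (filter P? (cartesianProductWith _∷_ (tabulate f) vs)) ≡
  ∑ (λ i → length (filter (P? ∘ (f i ∷_)) vs))
length-filter-product {zero}  P? f vs = refl
length-filter-product {suc n} P? f vs = begin
  length (filter P? (map (f zero ∷_) vs ++ rest))
    ≡⟨ cong length (filter-++ P? (map (f zero ∷_) vs) rest) ⟩
  length (filter P? (map (f zero ∷_) vs) ++ filter P? rest)
    ≡⟨ length-++ (filter P? (map (f zero ∷_) vs)) ⟩
  length (filter P? (map (f zero ∷_) vs)) + length (filter P? rest)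
    ≡⟨ cong₂ _+_ (length-filter-map P? (f zero ∷_) vs) (length-filter-product P? (f ∘ suc) vs) ⟩
  ∑ (λ i → length (filter (P? ∘ (f i ∷_)) vs)) ∎
  where
  open ≡-Reasoning
  rest = cartesianProductWith _∷_ (tabulate (f ∘ suc)) vs

length-filter-quadruples : ∀ {n} {P : Pred (Vec (Fin n) 4) 0ℓ} (P? : Decidable P) →
  length (filter P? (tuples 4 (allFin n))) ≡
  ∑ (λ a → ∑ λ b → ∑ λ c → ∑ λ d → ⟦ P? (a ∷ b ∷ c ∷ d ∷ []) ⟧)
length-filter-quadruples P? =
  trans (length-filter-product P? id _) (sum-cong-≗ λ a →
  trans (length-filter-product (λ v → P? (a ∷ v)) id _) (sum-cong-≗ λ b →
  trans (length-filter-product (λ v → P? (a ∷ b ∷ v)) id _) (sum-cong-≗ λ c →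
  trans (length-filter-product (λ v → P? (a ∷ b ∷ c ∷ v)) id _) (sum-cong-≗ λ d →
  single (λ v → P? (a ∷ b ∷ c ∷ d ∷ v))))))
  where
  single : ∀ {Q : Pred (Vec _ 0) 0ℓ} (Q? : Decidable Q) → length (filter Q? ([] ∷ [])) ≡ ⟦ Q? [] ⟧
  single Q? with does (Q? [])
  ... | true  = refl
  ... | false = refl

-- The f of the overview. Truncation makes it 0 for all d from n - 2 onwards.
weight : ℕ → ℕ → ℕ
weight n d = d * ((n ∸ 1 ∸ d) * (n ∸ 2 ∸ d))

module _ {n} (G : Graph n) where

  open ≡-Reasoning

  degree-∑ : ∀ v → degree G v ≡ ∑ (λ u → ⟦ adj? G v u ⟧)
  degree-∑ v = length-filter-tabulate (adj? G v) id

  NonAdj : Fin n → Fin n → Set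
  NonAdj u v = u ≢ v × ¬ Adj G u v

  nonAdj? : ∀ u v → Dec (NonAdj u v)
  nonAdj? u v = ¬? (u ≟ v) ×-dec ¬? (adj? G u v)

  codegree : Fin n → ℕ
  codegree v = ∑ (λ u → ⟦ nonAdj? v u ⟧)

  degree+codegree : ∀ v → suc (degree G v + codegree v) ≡ n
  degree+codegree v = begin
    suc (degree G v + codegree v)
      ≡⟨ cong₂ _+_ (sym (∑-single (λ _ → 1) v)) (cong (_+ codegree v) (degree-∑ v)) ⟩
    ∑ (λ u → ⟦ v ≟ u ⟧ * 1) + (∑ (λ u → ⟦ adj? G v u ⟧) + codegree v)
      ≡⟨ cong (∑ (λ u → ⟦ v ≟ u ⟧ * 1) +_) (sym (∑-distrib-+ (λ u → ⟦ adj? G v u ⟧) _)) ⟩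
    ∑ (λ u → ⟦ v ≟ u ⟧ * 1) + ∑ (λ u → ⟦ adj? G v u ⟧ + ⟦ nonAdj? v u ⟧)
      ≡⟨ sym (∑-distrib-+ (λ u → ⟦ v ≟ u ⟧ * 1) _) ⟩
    ∑ (λ u → ⟦ v ≟ u ⟧ * 1 + (⟦ adj? G v u ⟧ + ⟦ nonAdj? v u ⟧))
      ≡⟨ sum-cong-≗ trichotomy ⟩
    ∑ {n} (λ _ → 1)
      ≡⟨ trans (∑-const n 1) (ℕ.*-identityʳ n) ⟩
    n ∎
    where
    trichotomy : ∀ u → ⟦ v ≟ u ⟧ * 1 + (⟦ adj? G v u ⟧ + ⟦ nonAdj? v u ⟧) ≡ 1
    trichotomy u with v ≟ u | adj? G v u
    ... | yes v≡u | yes v~u = contradiction v~u (irreflexive G v≡u)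
    ... | yes _   | no _    = refl
    ... | no _    | yes _   = refl
    ... | no _    | no _    = refl

  -- Adding the diagonal pairs c = d completes the ordered pairs of distinct non-neighbours to a
  -- full square. The diagonal term enters as `N c * N c`, by idempotence of an indicator, so that
  -- `N c` can be factored out of its row.
  nonAdjacentPairs+codegree : ∀ v → ∑ (λ c → ⟦ nonAdj? v c ⟧ * ∑ (λ d → ⟦ nonAdj? v d ⟧ * ⟦ ¬? (c ≟ d) ⟧)) + codegree v
                ≡ codegree v * codegree v
  nonAdjacentPairs+codegree v = begin
    ∑ (λ c → N c * ∑ (λ d → N d * ⟦ ¬? (c ≟ d) ⟧)) + ∑ N
      ≡⟨ sym (∑-distrib-+ _ N) ⟩
    ∑ (λ c → N c * ∑ (λ d → N d * ⟦ ¬? (c ≟ d) ⟧) + N c)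
      ≡⟨ sum-cong-≗ row ⟩
    ∑ (λ c → N c * ∑ N)
      ≡⟨ sym (*-distribʳ-sum (∑ N) N) ⟩
    ∑ N * ∑ N ∎
    where
    N : Fin n → ℕ
    N c = ⟦ nonAdj? v c ⟧

    idem : ∀ c → N c ≡ N c * N c
    idem c with does (nonAdj? v c)
    ... | true  = refl
    ... | false = refl

    split : ∀ c d → N d * ⟦ ¬? (c ≟ d) ⟧ + ⟦ c ≟ d ⟧ * N d ≡ N d
    split c d with does (c ≟ d)
    ... | true  = trans (cong₂ _+_ (ℕ.*-zeroʳ (N d)) (ℕ.*-identityˡ (N d))) refl
    ... | false = trans (ℕ.+-identityʳ _) (ℕ.*-identityʳ (N d))

    row : ∀ c → N c * ∑ (λ d → N d * ⟦ ¬? (c ≟ d) ⟧) + N c ≡ N c * ∑ N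
    row c = begin
      N c * ∑ (λ d → N d * ⟦ ¬? (c ≟ d) ⟧) + N c
        ≡⟨ cong (N c * ∑ (λ d → N d * ⟦ ¬? (c ≟ d) ⟧) +_) (idem c) ⟩
      N c * ∑ (λ d → N d * ⟦ ¬? (c ≟ d) ⟧) + N c * N c
        ≡⟨ sym (ℕ.*-distribˡ-+ (N c) _ (N c)) ⟩
      N c * (∑ (λ d → N d * ⟦ ¬? (c ≟ d) ⟧) + N c)
        ≡⟨ cong (λ x → N c * (∑ (λ d → N d * ⟦ ¬? (c ≟ d) ⟧) + x)) (sym (∑-single N c)) ⟩
      N c * (∑ (λ d → N d * ⟦ ¬? (c ≟ d) ⟧) + ∑ (λ d → ⟦ c ≟ d ⟧ * N d))
        ≡⟨ cong (N c *_) (sym (∑-distrib-+ (λ d → N d * ⟦ ¬? (c ≟ d) ⟧) _)) ⟩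
      N c * ∑ (λ d → N d * ⟦ ¬? (c ≟ d) ⟧ + ⟦ c ≟ d ⟧ * N d)
        ≡⟨ cong (N c *_) (sum-cong-≗ (split c)) ⟩
      N c * ∑ N ∎

  codegree-∸ : ∀ v → n ∸ 1 ∸ degree G v ≡ codegree v
  codegree-∸ v = trans (cong (λ x → x ∸ 1 ∸ degree G v) (sym (degree+codegree v))) (ℕ.m+n∸m≡n (degree G v) _)

  nonAdjacentPairs : ∀ v → ∑ (λ c → ⟦ nonAdj? v c ⟧ * ∑ (λ d → ⟦ nonAdj? v d ⟧ * ⟦ ¬? (c ≟ d) ⟧))
                   ≡ (n ∸ 1 ∸ degree G v) * (n ∸ 2 ∸ degree G v)
  nonAdjacentPairs v = begin
    S                       ≡⟨ sym (ℕ.m+n∸n≡m S m) ⟩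
    S + m ∸ m               ≡⟨ cong (_∸ m) (nonAdjacentPairs+codegree v) ⟩
    m * m ∸ m               ≡⟨ cong (m * m ∸_) (sym (ℕ.*-identityʳ m)) ⟩
    m * m ∸ m * 1           ≡⟨ sym (ℕ.*-distribˡ-∸ m m 1) ⟩
    m * (m ∸ 1)             ≡⟨ cong (λ x → x * (x ∸ 1)) (sym (codegree-∸ v)) ⟩
    (n ∸ 1 ∸ degree G v) * (n ∸ 1 ∸ degree G v ∸ 1)
                            ≡⟨ cong ((n ∸ 1 ∸ degree G v) *_) shift ⟩
    (n ∸ 1 ∸ degree G v) * (n ∸ 2 ∸ degree G v) ∎
    where
    m = codegree v
    S = ∑ (λ c → ⟦ nonAdj? v c ⟧ * ∑ (λ d → ⟦ nonAdj? v d ⟧ * ⟦ ¬? (c ≟ d) ⟧))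

    shift : n ∸ 1 ∸ degree G v ∸ 1 ≡ n ∸ 2 ∸ degree G v
    shift = begin
      n ∸ 1 ∸ degree G v ∸ 1   ≡⟨ ℕ.∸-+-assoc (n ∸ 1) (degree G v) 1 ⟩
      n ∸ 1 ∸ (degree G v + 1) ≡⟨ cong (n ∸ 1 ∸_) (ℕ.+-comm (degree G v) 1) ⟩
      n ∸ 1 ∸ (1 + degree G v) ≡⟨ sym (ℕ.∸-+-assoc (n ∸ 1) 1 (degree G v)) ⟩
      n ∸ 1 ∸ 1 ∸ degree G v   ≡⟨ cong (_∸ degree G v) (ℕ.∸-+-assoc n 1 1) ⟩
      n ∸ 2 ∸ degree G v       ∎

  -- Injectivity reduced to what adjacency does not give: `b` differs from `a` by irreflexivity, and
  -- from `c` and `d` because it is adjacent to `a` while they are not. No condition links `b` to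
  -- `c` or `d`.
  Pattern : (a b c d : Fin n) → Set
  Pattern a b c d = Adj G a b × NonAdj a c × NonAdj a d × c ≢ d

  pattern? : ∀ a b c d → Dec (Pattern a b c d)
  pattern? a b c d = adj? G a b ×-dec nonAdj? a c ×-dec nonAdj? a d ×-dec ¬? (c ≟ d)

  embedding⇒pattern : ∀ {a b c d} → IsEmbedding H G (a ∷ b ∷ c ∷ d ∷ []) → Pattern a b c d
  embedding⇒pattern (inj , r , b) =
      r 0F 1F refl
    , ((λ eq → contradiction (inj {0F} {2F} eq) λ ()) , b 0F 2F refl)
    , ((λ eq → contradiction (inj {0F} {3F} eq) λ ()) , b 0F 3F refl)
    , λ eq → contradiction (inj {2F} {3F} eq) λ ()

  pattern⇒embedding : ∀ {a b c d} → Pattern a b c d → IsEmbedding H G (a ∷ b ∷ c ∷ d ∷ [])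
  pattern⇒embedding {a} {b} {c} {d} (ab , (a≢c , ac) , (a≢d , ad) , c≢d) =
      (λ {i} {j} → lookup-injective unique i j) , red-adj , blue-nonadj
    where
    f : Vec (Fin n) 4
    f = a ∷ b ∷ c ∷ d ∷ []

    unique = ((λ a≡b → irreflexive G a≡b ab) ∷ a≢c ∷ a≢d ∷ [])
           ∷ ((λ b≡c → ac (subst (Adj G a) b≡c ab)) ∷ (λ b≡d → ad (subst (Adj G a) b≡d ab)) ∷ [])
           ∷ (c≢d ∷ []) ∷ [] ∷ []

    red-adj : ∀ i j → colour H i j ≡ _ → Adj G (lookup f i) (lookup f j)
    red-adj 0F 1F _ = ab
    red-adj 1F 0F _ = symmetric G ab
    red-adj 0F 0F ()
    red-adj 0F 2F ()
    red-adj 0F 3F ()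
    red-adj 1F 1F ()
    red-adj 1F 2F ()
    red-adj 1F 3F ()
    red-adj 2F 0F ()
    red-adj 2F 1F ()
    red-adj 2F 2F ()
    red-adj 2F 3F ()
    red-adj 3F 0F ()
    red-adj 3F 1F ()
    red-adj 3F 2F ()
    red-adj 3F 3F ()

    blue-nonadj : ∀ i j → colour H i j ≡ _ → ¬ Adj G (lookup f i) (lookup f j)
    blue-nonadj 0F 2F _ = ac
    blue-nonadj 2F 0F _ = ac ∘ symmetric G
    blue-nonadj 0F 3F _ = ad
    blue-nonadj 3F 0F _ = ad ∘ symmetric G
    blue-nonadj 0F 0F ()
    blue-nonadj 0F 1F ()
    blue-nonadj 1F 0F ()
    blue-nonadj 1F 1F ()
    blue-nonadj 1F 2F ()
    blue-nonadj 1F 3F ()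
    blue-nonadj 2F 1F ()
    blue-nonadj 2F 2F ()
    blue-nonadj 2F 3F ()
    blue-nonadj 3F 1F ()
    blue-nonadj 3F 2F ()
    blue-nonadj 3F 3F ()

  -- For a fixed centre the conditions on `b` and on the pair `c`, `d` are independent, so the
  -- triple sum is a product.
  Λ-∑ : Λ H G ≡ ∑ (λ v → weight n (degree G v))
  Λ-∑ = trans (length-filter-quadruples (isEmbedding? H G)) (sum-cong-≗ λ a → begin
    ∑ (λ b → ∑ λ c → ∑ λ d → ⟦ isEmbedding? H G (a ∷ b ∷ c ∷ d ∷ []) ⟧)
      ≡⟨ (sum-cong-≗ λ b → sum-cong-≗ λ c → sum-cong-≗ λ d → indicator a b c d) ⟩
    ∑ (λ b → ∑ λ c → ∑ λ d → ⟦ adj? G a b ⟧ * (⟦ nonAdj? a c ⟧ * (⟦ nonAdj? a d ⟧ * ⟦ ¬? (c ≟ d) ⟧)))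
      ≡⟨ (sum-cong-≗ λ b → sum-cong-≗ λ c → factor a b c) ⟩
    ∑ (λ b → ∑ λ c → ⟦ adj? G a b ⟧ * (⟦ nonAdj? a c ⟧ * ∑ λ d → ⟦ nonAdj? a d ⟧ * ⟦ ¬? (c ≟ d) ⟧))
      ≡⟨ ∑∑-* {n} {n} (λ b → ⟦ adj? G a b ⟧) _ ⟩
    ∑ (λ b → ⟦ adj? G a b ⟧) * ∑ (λ c → ⟦ nonAdj? a c ⟧ * ∑ λ d → ⟦ nonAdj? a d ⟧ * ⟦ ¬? (c ≟ d) ⟧)
      ≡⟨ cong₂ _*_ (sym (degree-∑ a)) (nonAdjacentPairs a) ⟩
    weight n (degree G a) ∎)
    where
    indicator : ∀ a b c d → ⟦ isEmbedding? H G (a ∷ b ∷ c ∷ d ∷ []) ⟧ ≡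
      ⟦ adj? G a b ⟧ * (⟦ nonAdj? a c ⟧ * (⟦ nonAdj? a d ⟧ * ⟦ ¬? (c ≟ d) ⟧))
    indicator a b c d = begin
      ⟦ isEmbedding? H G (a ∷ b ∷ c ∷ d ∷ []) ⟧
        ≡⟨ ⟦⟧-cong (isEmbedding? H G (a ∷ b ∷ c ∷ d ∷ [])) (pattern? a b c d) embedding⇒pattern pattern⇒embedding ⟩
      ⟦ pattern? a b c d ⟧
        ≡⟨ ⟦⟧-× (adj? G a b) (nonAdj? a c ×-dec nonAdj? a d ×-dec ¬? (c ≟ d)) ⟩
      ⟦ adj? G a b ⟧ * ⟦ nonAdj? a c ×-dec nonAdj? a d ×-dec ¬? (c ≟ d) ⟧
        ≡⟨ cong (⟦ adj? G a b ⟧ *_) (trans (⟦⟧-× (nonAdj? a c) (nonAdj? a d ×-dec ¬? (c ≟ d)))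
             (cong (⟦ nonAdj? a c ⟧ *_) (⟦⟧-× (nonAdj? a d) (¬? (c ≟ d))))) ⟩
      ⟦ adj? G a b ⟧ * (⟦ nonAdj? a c ⟧ * (⟦ nonAdj? a d ⟧ * ⟦ ¬? (c ≟ d) ⟧)) ∎

    factor : ∀ a b c →
      ∑ (λ d → ⟦ adj? G a b ⟧ * (⟦ nonAdj? a c ⟧ * (⟦ nonAdj? a d ⟧ * ⟦ ¬? (c ≟ d) ⟧))) ≡
      ⟦ adj? G a b ⟧ * (⟦ nonAdj? a c ⟧ * ∑ λ d → ⟦ nonAdj? a d ⟧ * ⟦ ¬? (c ≟ d) ⟧)
    factor a b c = sym (trans
      (cong (⟦ adj? G a b ⟧ *_) (*-distribˡ-sum {n} ⟦ nonAdj? a c ⟧ _))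
      (*-distribˡ-sum {n} ⟦ adj? G a b ⟧ _))

-- Unimodality of the weight

weight-value : ∀ {n d} m → n ≡ 2 + m + d → weight n d ≡ d * (suc m * m)
weight-value {d = d} m refl = cong₂ (λ x y → d * (x * y)) (ℕ.m+n∸n≡m (suc m) d) (ℕ.m+n∸n≡m m d)

weight-zero : ∀ {n d} → n ≤ 2 + d → weight n d ≡ 0
weight-zero {n} {d} n≤2+d = begin
  d * ((n ∸ 1 ∸ d) * (n ∸ 2 ∸ d)) ≡⟨ cong (λ x → d * ((n ∸ 1 ∸ d) * x)) n∸2∸d≡0 ⟩
  d * ((n ∸ 1 ∸ d) * 0)           ≡⟨ cong (d *_) (ℕ.*-zeroʳ (n ∸ 1 ∸ d)) ⟩
  d * 0                           ≡⟨ ℕ.*-zeroʳ d ⟩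
  0                               ∎
  where
  open ≡-Reasoning
  n∸2∸d≡0 : n ∸ 2 ∸ d ≡ 0
  n∸2∸d≡0 = trans (ℕ.∸-+-assoc n 2 d) (ℕ.m≤n⇒m∸n≡0 n≤2+d)

private
  rising-size : ∀ d o → 3 * suc d + o ≡ 2 + (2 * d + o) + suc d
  rising-size = solve-∀

  rising-size′ : ∀ d o → 3 * suc d + o ≡ 2 + (1 + (2 * d + o)) + d
  rising-size′ = solve-∀

  rising-weight : ∀ d o → suc d * (suc (2 * d + o) * (2 * d + o)) ≡
    d * ((2 + (2 * d + o)) * (1 + (2 * d + o))) + suc (2 * d + o) * o
  rising-weight = solve-∀

  falling-weight : ∀ d b → d * ((2 + b) * (1 + b)) + suc b * b ≡ suc d * (suc b * b) + suc b * (2 * d)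
  falling-weight = solve-∀

  three-times-suc : ∀ d → 3 * suc d ≡ 3 + d + 2 * d
  three-times-suc = solve-∀

-- The slack `o` is n - 3 - 3d and `suc (2 * d + o)` is n - 2 - d, the two factors of the increment.
weight-rising : ∀ {n} d o → n ≡ 3 * suc d + o → weight n (suc d) ≡ weight n d + suc (2 * d + o) * o
weight-rising {n} d o n≡ = begin
  weight n (suc d)
    ≡⟨ weight-value (2 * d + o) (trans n≡ (rising-size d o)) ⟩
  suc d * (suc (2 * d + o) * (2 * d + o))
    ≡⟨ rising-weight d o ⟩
  d * ((2 + (2 * d + o)) * (1 + (2 * d + o))) + suc (2 * d + o) * o
    ≡⟨ cong (_+ suc (2 * d + o) * o) (sym (weight-value (1 + (2 * d + o)) (trans n≡ (rising-size′ d o)))) ⟩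
  weight n d + suc (2 * d + o) * o ∎
  where open ≡-Reasoning

-- Past the peak the sign changes: `o` is 3d + 3 - n and `suc b` is n - 2 - d. Adding `suc b * b` to
-- both sides lets 2d appear, which is then replaced by `b + o`.
weight-falling : ∀ {n} d b o → n ≡ 3 + b + d → b + o ≡ 2 * d → weight n d ≡ weight n (suc d) + suc b * o
weight-falling {n} d b o n≡ b+o≡2d = ℕ.+-cancelʳ-≡ (suc b * b) _ _ (begin
  weight n d + suc b * b
    ≡⟨ cong (_+ suc b * b) (weight-value (suc b) n≡) ⟩
  d * ((2 + b) * (1 + b)) + suc b * b
    ≡⟨ falling-weight d b ⟩
  suc d * (suc b * b) + suc b * (2 * d)
    ≡⟨ cong₂ _+_ (sym (weight-value b (trans n≡ (sym (ℕ.+-suc (2 + b) d))))) (cong (suc b *_) (sym b+o≡2d)) ⟩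
  weight n (suc d) + suc b * (b + o)
    ≡⟨ cong (weight n (suc d) +_) (trans (ℕ.*-distribˡ-+ (suc b) b o) (ℕ.+-comm (suc b * b) _)) ⟩
  weight n (suc d) + (suc b * o + suc b * b)
    ≡⟨ sym (ℕ.+-assoc (weight n (suc d)) _ _) ⟩
  weight n (suc d) + suc b * o + suc b * b ∎)
  where open ≡-Reasoning

weight-step-≤ : ∀ {n} d → 3 * suc d ≤ n → weight n d ≤ weight n (suc d)
weight-step-≤ {n} d 3+3d≤n = let (o , eq) = ℕ.m≤n⇒∃[o]m+o≡n 3+3d≤n in
  subst (weight n d ≤_) (sym (weight-rising d o (sym eq))) (ℕ.m≤m+n _ _)

weight-step-< : ∀ {n} d → 3 * suc d < n → weight n d < weight n (suc d)
weight-step-< {n} d 3+3d<n = let (o , eq) = ℕ.m≤n⇒∃[o]m+o≡n 3+3d<n in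
  subst (weight n d <_) (sym (weight-rising d (suc o) (trans (sym eq) (sym (ℕ.+-suc (3 * suc d) o)))))
    (ℕ.m<m+n _ (s≤s z≤n))

private
  falling-gap : ∀ {n d b} → 3 + d + b ≡ n → n ≤ 3 * suc d → b ≤ 2 * d
  falling-gap {n} {d} {b} eq n≤ = ℕ.+-cancelˡ-≤ (3 + d) _ _
    (subst₂ _≤_ (sym eq) (three-times-suc d) n≤)

  falling-size : ∀ {n} d b → 3 + d + b ≡ n → n ≡ 3 + b + d
  falling-size d b eq = trans (sym eq) (cong (3 +_) (ℕ.+-comm d b))

weight-step-> : ∀ {n} d → 3 + d ≤ n → n < 3 * suc d → weight n (suc d) < weight n d
weight-step-> {n} d 3+d≤n n<3+3d =
  let (b , eq)  = ℕ.m≤n⇒∃[o]m+o≡n 3+d≤n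
      -- Raising both n and b by one turns the bound into b < 2d, so that the slack is `suc o` and
      -- the drop is positive.
      (o , eq′) = ℕ.m≤n⇒∃[o]m+o≡n (falling-gap {suc n} {d} {suc b} (trans (ℕ.+-suc (3 + d) b) (cong suc eq)) n<3+3d)
  in subst (weight n (suc d) <_)
       (sym (weight-falling d b (suc o) (falling-size d b eq) (trans (ℕ.+-suc b o) eq′)))
       (ℕ.m<m+n _ (s≤s z≤n))

weight-step-≥ : ∀ {n} d → n ≤ 3 * suc d → weight n (suc d) ≤ weight n d
weight-step-≥ {n} d n≤3+3d with 3 + d ≤? n
-- The falling formula requires 3 + d ≤ n; here the weight at `suc d` has already reached 0.
... | no  3+d≰n = subst (_≤ weight n d) (sym (weight-zero {n} {suc d} (ℕ.<⇒≤ (ℕ.≰⇒> 3+d≰n)))) z≤n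
... | yes 3+d≤n =
  let (b , eq)  = ℕ.m≤n⇒∃[o]m+o≡n 3+d≤n
      (o , eq′) = ℕ.m≤n⇒∃[o]m+o≡n (falling-gap eq n≤3+3d)
  in subst (weight n (suc d) ≤_) (sym (weight-falling d b o (falling-size d b eq) eq′)) (ℕ.m≤m+n _ _)

weight-mono-≤ : ∀ {n d t} → 3 * t ≤ n → d ≤ t → weight n d ≤ weight n t
weight-mono-≤ {n} {d} 3t≤n d≤t = go 3t≤n (ℕ.≤⇒≤′ d≤t)
  where
  go : ∀ {t} → 3 * t ≤ n → d ≤′ t → weight n d ≤ weight n t
  go 3t≤n ≤′-refl               = ℕ.≤-refl
  go 3t≤n (≤′-step {n = t} d≤t) = ℕ.≤-trans
    (go (ℕ.≤-trans (ℕ.*-monoʳ-≤ 3 (ℕ.n≤1+n t)) 3t≤n) d≤t) (weight-step-≤ t 3t≤n)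

weight-anti-≤ : ∀ {n d t} → n ≤ 3 * suc t → t ≤ d → weight n d ≤ weight n t
weight-anti-≤ {n} {d} {t} n≤3+3t t≤d = go (ℕ.≤⇒≤′ t≤d)
  where
  go : ∀ {d} → t ≤′ d → weight n d ≤ weight n t
  go ≤′-refl               = ℕ.≤-refl
  go (≤′-step {n = d} t≤d) = ℕ.≤-trans
    (weight-step-≥ d (ℕ.≤-trans n≤3+3t (ℕ.*-monoʳ-≤ 3 (s≤s (ℕ.≤′⇒≤ t≤d))))) (go t≤d)

weight-mono-< : ∀ {n d t} → 3 * t < n → d < t → weight n d < weight n t
weight-mono-< {t = suc t} 3t<n d<t = ℕ.≤-<-trans
  (weight-mono-≤ (ℕ.≤-trans (ℕ.*-monoʳ-≤ 3 (ℕ.n≤1+n t)) (ℕ.<⇒≤ 3t<n)) (s≤s⁻¹ d<t))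
  (weight-step-< t 3t<n)

-- Only the first step after `t` is taken strictly: from n - 2 onwards the weight is constantly 0,
-- so strictness does not persist.
weight-anti-< : ∀ {n d t} → n < 3 * suc t → 3 + t ≤ n → t < d → weight n d < weight n t
weight-anti-< {t = t} n<3+3t 3+t≤n t<d = ℕ.≤-<-trans
  (weight-anti-≤ (ℕ.≤-trans (ℕ.<⇒≤ n<3+3t) (ℕ.*-monoʳ-≤ 3 (ℕ.n≤1+n (suc t)))) t<d)
  (weight-step-> t 3+t≤n n<3+3t)

-- Balanced products

record Maximiser (N a b c : ℕ) : Set where
  constructor _,_
  field
    sum≡N      : a + b + c ≡ N
    product≡π₃ : a * b * c ≡ π₃ N

-- With the rotation below this generates all permutations, so a fact about the first two parts
-- applies to any two.
maximiser-swap : ∀ {N a b c} → Maximiser N a b c → Maximiser N b a c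
maximiser-swap {a = a} {b} {c} (s , p) =
  trans (cong (_+ c) (ℕ.+-comm b a)) s , trans (cong (_* c) (ℕ.*-comm b a)) p

maximiser-rotate : ∀ {N a b c} → Maximiser N a b c → Maximiser N b c a
maximiser-rotate {a = a} {b} {c} (s , p) =
  trans (ℕ.+-comm (b + c) a) (trans (sym (ℕ.+-assoc a b c)) s) ,
  trans (ℕ.*-comm (b * c) a) (trans (sym (ℕ.*-assoc a b c)) p)

private
  triple-product : ∀ x y z → x * (y * (z * 1)) ≡ x * y * z
  triple-product = solve-∀

  triple-sum : ∀ x y z → x + y + z ≡ x + (y + (z + 0))
  triple-sum = solve-∀

  attained-sum : ∀ q r → q + (q + (q + r + 0)) ≡ 3 * q + r
  attained-sum = solve-∀

  shifted-sum : ∀ b k c → 1 + b + k + (1 + b + (c + 0)) ≡ 2 + b + k + b + c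
  shifted-sum = solve-∀

  below : ∀ a k r → a + suc a + suc a + suc (3 * k + r) ≡ 3 * (suc a + k) + r
  below = solve-∀

  above : ∀ q k → 3 * q + 3 + suc (3 * k) ≡ 2 + q + k + (1 + q + k) + (1 + q + k)
  above = solve-∀

  swap₁₂ : ∀ x y z → x * y * z ≡ y * x * z
  swap₁₂ = solve-∀

  swap₁₃ : ∀ x y z → x * y * z ≡ z * y * x
  swap₁₃ = solve-∀

  swap₂₃ : ∀ x y z → x * y * z ≡ x * z * y
  swap₂₃ = solve-∀

  raised-sum : ∀ q x y z → x + q + (y + q) + (z + q) ≡ 3 * q + (x + y + z)
  raised-sum = solve-∀

  shifted-product : ∀ b k c → (2 + b + k) * b * c + (c + k * c) ≡ (1 + b + k) * (1 + b) * c
  shifted-product = solve-∀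

-- Moving a unit between two parts that differ by at least 2 increases the product.
maximiser-not-unbalanced : ∀ {N} b k c → 0 < π₃ N → ¬ Maximiser N (2 + b + k) b c
maximiser-not-unbalanced {N} b k c pos (s , eq) = ℕ.<⇒≱ worse better
  where
  open ℕ.≤-Reasoning

  better : (1 + b + k) * (1 + b) * c ≤ π₃ N
  better = subst (_≤ π₃ N) (triple-product (1 + b + k) (1 + b) c)
    (IsMaximum.upperBound (π₃-isMaximum N)
      ((1 + b + k) ∷ (1 + b) ∷ c ∷ [] , trans (shifted-sum b k c) s))

  -- The exchange gains (1 + k) c, which is nothing for c = 0; a positive maximum excludes that.
  0<c : 0 < c
  0<c = ℕ.n≢0⇒n>0 λ c≡0 → ℕ.<⇒≢ pos
    (trans (sym (trans (cong ((2 + b + k) * b *_) c≡0) (ℕ.*-zeroʳ ((2 + b + k) * b)))) eq)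

  worse : π₃ N < (1 + b + k) * (1 + b) * c
  worse = subst₂ _<_ eq (shifted-product b k c) (ℕ.m<m+n _ (ℕ.<-≤-trans 0<c (ℕ.m≤m+n c (k * c))))

maximiser-balanced : ∀ {N a b c} → 0 < π₃ N → Maximiser N a b c → a ≤ suc b
maximiser-balanced {N} {a} {b} {c} pos m = ℕ.≮⇒≥ λ 1+b<a →
  let (k , eq) = ℕ.m≤n⇒∃[o]m+o≡n 1+b<a in
  maximiser-not-unbalanced b k c pos (subst (λ a → Maximiser N a b c) (sym eq) m)

-- Otherwise the sum is at most 3a + 2, which is less than 3 (a + 1) ≤ 3q.
q≤part : ∀ {q r} a b c → a + b + c ≡ 3 * q + r → b ≤ suc a → c ≤ suc a → q ≤ a
q≤part {q} {r} a b c s b≤ c≤ with q ≤? a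
... | yes q≤a = q≤a
... | no  q≰a with k , refl ← ℕ.m≤n⇒∃[o]m+o≡n (ℕ.≰⇒> q≰a) = contradiction
  (begin-strict
    a + b + c              ≤⟨ ℕ.+-mono-≤ (ℕ.+-monoʳ-≤ a b≤) c≤ ⟩
    a + suc a + suc a      <⟨ ℕ.m<m+n _ (s≤s z≤n) ⟩
    a + suc a + suc a + suc (3 * k + r) ≡⟨ below a k r ⟩
    3 * (suc a + k) + r    ∎)
  (ℕ.<-irrefl s)
  where open ℕ.≤-Reasoning

-- Otherwise a ≥ q + 2, the other parts are at least q + 1, and the sum is at least 3q + 4.
part≤1+q : ∀ {q r} a b c → a + b + c ≡ 3 * q + r → r ≤ 3 → a ≤ suc b → a ≤ suc c → a ≤ suc q
part≤1+q {q} {r} a b c s r≤3 a≤b a≤c with a ≤? suc q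
... | yes p = p
... | no  p with k , refl ← ℕ.m≤n⇒∃[o]m+o≡n (ℕ.≰⇒> p) = contradiction
  (begin-strict
    3 * q + r              ≤⟨ ℕ.+-monoʳ-≤ (3 * q) r≤3 ⟩
    3 * q + 3              <⟨ ℕ.m<m+n _ (s≤s z≤n) ⟩
    3 * q + 3 + suc (3 * k) ≡⟨ above q k ⟩
    2 + q + k + (1 + q + k) + (1 + q + k) ≤⟨ ℕ.+-mono-≤ (ℕ.+-monoʳ-≤ (2 + q + k) (s≤s⁻¹ a≤b)) (s≤s⁻¹ a≤c) ⟩
    2 + q + k + b + c      ∎)
  (ℕ.<-irrefl (sym s))
  where open ℕ.≤-Reasoning

balancedProduct : ℕ → ℕ → ℕ
balancedProduct q 0 = q * q * q
balancedProduct q 1 = q * q * suc q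
balancedProduct q 2 = q * suc q * suc q
balancedProduct q _ = suc q * suc q * suc q

q-or-1+q : ∀ {q a} → q ≤ a → a ≤ suc q → a ≡ q ⊎ a ≡ suc q
q-or-1+q q≤a a≤1+q with ℕ.m≤n⇒m<n∨m≡n q≤a
... | inj₁ q<a = inj₂ (ℕ.≤-antisym a≤1+q q<a)
... | inj₂ q≡a = inj₁ (sym q≡a)

product-of-near-equal : ∀ {q r a b c} → a + b + c ≡ 3 * q + r →
  a ≡ q ⊎ a ≡ suc q → b ≡ q ⊎ b ≡ suc q → c ≡ q ⊎ c ≡ suc q → a * b * c ≡ balancedProduct q r
product-of-near-equal {q} {r} s a∈ b∈ c∈ = go a∈ b∈ c∈ s
  where
  excess : ∀ {e S} → S ≡ 3 * q + e → S ≡ 3 * q + r → balancedProduct q e ≡ balancedProduct q r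
  excess p s = cong (balancedProduct q) (ℕ.+-cancelˡ-≡ (3 * q) _ _ (trans (sym p) s))

  go : ∀ {a b c} → a ≡ q ⊎ a ≡ suc q → b ≡ q ⊎ b ≡ suc q → c ≡ q ⊎ c ≡ suc q →
    a + b + c ≡ 3 * q + r → a * b * c ≡ balancedProduct q r
  go (inj₁ refl) (inj₁ refl) (inj₁ refl) s = excess (raised-sum q 0 0 0) s
  go (inj₁ refl) (inj₁ refl) (inj₂ refl) s = excess (raised-sum q 0 0 1) s
  go (inj₁ refl) (inj₂ refl) (inj₁ refl) s = trans (swap₂₃ q (suc q) q) (excess (raised-sum q 0 1 0) s)
  go (inj₁ refl) (inj₂ refl) (inj₂ refl) s = excess (raised-sum q 0 1 1) s
  go (inj₂ refl) (inj₁ refl) (inj₁ refl) s = trans (swap₁₃ (suc q) q q) (excess (raised-sum q 1 0 0) s)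
  go (inj₂ refl) (inj₁ refl) (inj₂ refl) s = trans (swap₁₂ (suc q) q (suc q)) (excess (raised-sum q 1 0 1) s)
  go (inj₂ refl) (inj₂ refl) (inj₁ refl) s = trans (swap₁₃ (suc q) (suc q) q) (excess (raised-sum q 1 1 0) s)
  go (inj₂ refl) (inj₂ refl) (inj₂ refl) s = excess (raised-sum q 1 1 1) s

-- `π₃` is a search over triples, so it is not evaluated: a triple that attains it has parts
-- differing by at most 1, and these determine its product. The triple q, q, q + r shows that the
-- maximum is positive.
π₃-value : ∀ q r → 0 < q → r ≤ 3 → π₃ (3 * q + r) ≡ balancedProduct q r
π₃-value q r 0<q r≤3 with IsMaximum.attained (π₃-isMaximum (3 * q + r))
... | (a ∷ b ∷ c ∷ [] , s) , eq =
  trans (sym (Maximiser.product≡π₃ m)) (product-of-near-equal {q} (Maximiser.sum≡N m)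
    (part m) (part (maximiser-rotate m)) (part (maximiser-rotate (maximiser-rotate m))))
  where
  N = 3 * q + r

  m : Maximiser N a b c
  m = trans (triple-sum a b c) s , trans (sym (triple-product a b c)) eq

  pos : 0 < π₃ N
  pos = ℕ.<-≤-trans
    (ℕ.*-mono-≤ 0<q (ℕ.*-mono-≤ 0<q (ℕ.≤-trans 0<q (ℕ.≤-trans (ℕ.m≤m+n q r) (ℕ.m≤m*n (q + r) 1)))))
    (IsMaximum.upperBound (π₃-isMaximum N) (q ∷ q ∷ (q + r) ∷ [] , attained-sum q r))

  part : ∀ {a b c} → Maximiser N a b c → a ≡ q ⊎ a ≡ suc q
  part {a} {b} {c} m = q-or-1+q
    (q≤part a b c (Maximiser.sum≡N m) (balanced (maximiser-swap m)) (balanced (maximiser-rotate (maximiser-rotate m))))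
    (part≤1+q a b c (Maximiser.sum≡N m) r≤3 (balanced m) (balanced (maximiser-swap (maximiser-rotate (maximiser-rotate m)))))
    where
    balanced : ∀ {a b c} → Maximiser N a b c → a ≤ suc b
    balanced = maximiser-balanced pos

-- Sums over vertices and the extremal graphs

-- By symmetry the first row and the first column have equal sums, so together they contribute an
-- even number; the rest is a smaller matrix of the same kind.
∑∑-symmetric-even : ∀ {n} (f : Fin n → Fin n → ℕ) → (∀ i j → f i j ≡ f j i) → (∀ i → f i i ≡ 0) →
  ∃ λ e → ∑ (λ i → ∑ (f i)) ≡ 2 * e
∑∑-symmetric-even {zero}  f f-sym f-diag = 0 , refl
∑∑-symmetric-even {suc n} f f-sym f-diag =
  let (e , eq) = ∑∑-symmetric-even (λ i j → f (suc i) (suc j)) (λ i j → f-sym (suc i) (suc j)) (f-diag ∘ suc)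
      row      = ∑ (λ j → f zero (suc j))
  in row + e , (begin
    f zero zero + row + ∑ (λ i → f (suc i) zero + ∑ (λ j → f (suc i) (suc j)))
      ≡⟨ cong₂ _+_ (cong (_+ row) (f-diag zero))
                   (∑-distrib-+ (λ i → f (suc i) zero) (λ i → ∑ (λ j → f (suc i) (suc j)))) ⟩
    row + (∑ (λ i → f (suc i) zero) + ∑ (λ i → ∑ (λ j → f (suc i) (suc j))))
      ≡⟨ cong₂ (λ x y → row + (x + y)) (sum-cong-≗ (λ i → f-sym (suc i) zero)) eq ⟩
    row + (row + 2 * e)
      ≡⟨ double row e ⟩
    2 * (row + e) ∎)
  where
  open ≡-Reasoning
  double : ∀ x y → x + (x + 2 * y) ≡ 2 * (x + y)
  double = solve-∀

handshake : ∀ {n} (G : Graph n) → ∃ λ e → ∑ (degree G) ≡ 2 * e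
handshake G = let (e , eq) = ∑∑-symmetric-even (λ u v → ⟦ adj? G u v ⟧)
                    (λ u v → ⟦⟧-cong (adj? G u v) (adj? G v u) (symmetric G) (symmetric G)) loopless′
              in e , trans (sum-cong-≗ (degree-∑ G)) eq
  where
  loopless′ : ∀ v → ⟦ adj? G v v ⟧ ≡ 0
  loopless′ v with adj? G v v
  ... | yes v~v = contradiction v~v (irreflexive G refl)
  ... | no _    = refl

-- Both sides are the sum of `h` over 0, ..., n.
∑-shift : ∀ n (h : ℕ → ℕ) → ∑ {n} (λ j → h (suc (toℕ j))) + h 0 ≡ ∑ {n} (λ j → h (toℕ j)) + h n
∑-shift zero    h = refl
∑-shift (suc n) h = begin
  h 1 + ∑ {n} (λ j → h (2 + toℕ j)) + h 0    ≡⟨ rotate (h 1) _ (h 0) ⟩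
  h 0 + (∑ {n} (λ j → h (2 + toℕ j)) + h 1)  ≡⟨ cong (h 0 +_) (∑-shift n (h ∘ suc)) ⟩
  h 0 + (∑ {n} (λ j → h (suc (toℕ j))) + h (suc n)) ≡⟨ sym (ℕ.+-assoc (h 0) _ _) ⟩
  h 0 + ∑ {n} (λ j → h (suc (toℕ j))) + h (suc n) ∎
  where
  open ≡-Reasoning
  rotate : ∀ x y z → x + y + z ≡ z + (y + x)
  rotate = solve-∀

∑-periodic : ∀ n (h : ℕ → ℕ) → (∀ x → h (x + n) ≡ h x) → ∀ s → ∑ {n} (λ j → h (s + toℕ j)) ≡ ∑ {n} (λ j → h (toℕ j))
∑-periodic n h periodic zero    = refl
∑-periodic n h periodic (suc s) = trans (ℕ.+-cancelʳ-≡ (h s) _ _ (begin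
  ∑ {n} (λ j → h (suc s + toℕ j)) + h s
    ≡⟨ cong₂ _+_ (sum-cong-≗ {n} λ j → cong h (sym (ℕ.+-suc s (toℕ j)))) (cong h (sym (ℕ.+-identityʳ s))) ⟩
  ∑ {n} (λ j → h (s + suc (toℕ j))) + h (s + 0)
    ≡⟨ ∑-shift n (λ x → h (s + x)) ⟩
  ∑ {n} (λ j → h (s + toℕ j)) + h (s + n)
    ≡⟨ cong (∑ {n} (λ j → h (s + toℕ j)) +_) (periodic s) ⟩
  ∑ {n} (λ j → h (s + toℕ j)) + h s ∎)) (∑-periodic n h periodic s)
  where open ≡-Reasoning

∑-<? : ∀ {n d} → d ≤ n → ∑ {n} (λ j → ⟦ toℕ j <? d ⟧) ≡ d
∑-<? {n}     {zero}  _         = trans (∑-const n 0) (ℕ.*-zeroʳ n)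
∑-<? {suc n} {suc d} (s≤s d≤n) = cong suc (∑-<? {n} {d} d≤n)

∑-splitAt : ∀ m {n} (f : Fin m ⊎ Fin n → ℕ) → ∑ (λ i → f (splitAt m i)) ≡ ∑ (f ∘ inj₁) + ∑ (f ∘ inj₂)
∑-splitAt zero    f = refl
∑-splitAt (suc m) f = trans (cong (f (inj₁ zero) +_) (∑-splitAt m (f ∘ Sum.map₁ suc)))
  (sym (ℕ.+-assoc (f (inj₁ zero)) _ _))

-- A bipartite circulant graph on two classes of M vertices, from which c edges of the perfect
-- matching i + j = M − 1 are removed; their 2c ends are joined to each of e further vertices.
module Construction (M d c e : ℕ) .{{_ : NonZero M}}
  (0<d : 0 < d) (d≤M : d ≤ M) (c≤M : c ≤ M) (e-or-c : e ≡ 1 ⊎ c ≡ 0) where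

  open ≡-Reasoning

  Vertex : Set
  Vertex = Fin M ⊎ (Fin M ⊎ Fin e)

  pattern left i  = inj₁ i
  pattern right j = inj₂ (inj₁ j)
  pattern apex x  = inj₂ (inj₂ x)

  -- The offset by one gives the matching pairs i + j = M - 1 the residue 0, which is below `d`; so
  -- every removed pair is an edge of the circulant graph. Dependence on i + j alone makes rows and
  -- columns interchangeable.
  Circulant Removed Link : (i j : Fin M) → Set
  Circulant i j = suc (toℕ i + toℕ j) % M < d
  Removed i j   = suc (toℕ i + toℕ j) ≡ M × toℕ i < c
  Link i j      = Circulant i j × ¬ Removed i j

  -- The partner j = M - 1 - i of a left vertex with i < c is characterised by M ≤ j + c.
  Edge : Rel Vertex 0ℓ
  Edge (left i)  (right j) = Link i j
  Edge (right j) (left i)  = Link i j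
  Edge (left i)  (apex _)  = toℕ i < c
  Edge (apex _)  (left i)  = toℕ i < c
  Edge (right j) (apex _)  = M ≤ toℕ j + c
  Edge (apex _)  (right j) = M ≤ toℕ j + c
  Edge (left _)  (left _)  = ⊥
  Edge (right _) (right _) = ⊥
  Edge (apex _)  (apex _)  = ⊥

  circulant? : ∀ i j → Dec (Circulant i j)
  circulant? i j = suc (toℕ i + toℕ j) % M <? d

  removed? : ∀ i j → Dec (Removed i j)
  removed? i j = (suc (toℕ i + toℕ j) ℕ.≟ M) ×-dec (toℕ i <? c)

  link? : ∀ i j → Dec (Link i j)
  link? i j = circulant? i j ×-dec ¬? (removed? i j)

  edge? : Decidable₂ Edge
  edge? (left i)  (right j) = link? i j
  edge? (right j) (left i)  = link? i j
  edge? (left i)  (apex _)  = toℕ i <? c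
  edge? (apex _)  (left i)  = toℕ i <? c
  edge? (right j) (apex _)  = M ≤? toℕ j + c
  edge? (apex _)  (right j) = M ≤? toℕ j + c
  edge? (left _)  (left _)  = no λ ()
  edge? (right _) (right _) = no λ ()
  edge? (apex _)  (apex _)  = no λ ()

  edge-sym : ∀ u v → Edge u v → Edge v u
  edge-sym (left _)  (right _) = id
  edge-sym (right _) (left _)  = id
  edge-sym (left _)  (apex _)  = id
  edge-sym (apex _)  (left _)  = id
  edge-sym (right _) (apex _)  = id
  edge-sym (apex _)  (right _) = id

  edge-irrefl : ∀ u → ¬ Edge u u
  edge-irrefl (left _)  ()
  edge-irrefl (right _) ()
  edge-irrefl (apex _)  ()

  vertex : Fin (M + (M + e)) → Vertex
  vertex = Sum.map₂ (splitAt M) ∘ splitAt M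

  G : Graph (M + (M + e))
  G = record
    { Adj         = λ u v → Edge (vertex u) (vertex v)
    ; adj?        = λ u v → edge? (vertex u) (vertex v)
    ; symmetric   = λ {u} {v} → edge-sym (vertex u) (vertex v)
    ; irreflexive = λ { {u} refl → edge-irrefl (vertex u) }
    }

  ∑-vertex : (f : Vertex → ℕ) → ∑ (f ∘ vertex) ≡ ∑ (f ∘ left) + (∑ (f ∘ right) + ∑ (f ∘ apex))
  ∑-vertex f = trans (∑-splitAt M (f ∘ Sum.map₂ (splitAt M)))
    (cong (∑ (f ∘ left) +_) (∑-splitAt M (f ∘ inj₂)))

  -- As j varies, i + j + 1 runs through M consecutive numbers, hence once through each residue; `d`
  -- of these are below `d`.
  ∑-circulant : ∀ i → ∑ (λ j → ⟦ circulant? i j ⟧) ≡ d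
  ∑-circulant i = begin
    ∑ {M} (λ j → ⟦ suc (toℕ i + toℕ j) % M <? d ⟧)
      ≡⟨ ∑-periodic M (λ x → ⟦ x % M <? d ⟧) (λ x → cong (λ r → ⟦ r <? d ⟧) ([m+n]%n≡m%n x M)) (suc (toℕ i)) ⟩
    ∑ {M} (λ j → ⟦ toℕ j % M <? d ⟧)
      ≡⟨ sum-cong-≗ {M} (λ j → cong (λ r → ⟦ r <? d ⟧) (m<n⇒m%n≡m (toℕ<n j))) ⟩
    ∑ {M} (λ j → ⟦ toℕ j <? d ⟧)
      ≡⟨ ∑-<? d≤M ⟩
    d ∎

  ∑-matching : ∀ i {P : Set} (P? : Dec P) → ∑ {M} (λ j → ⟦ (suc (toℕ i + toℕ j) ℕ.≟ M) ×-dec P? ⟧) ≡ ⟦ P? ⟧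
  ∑-matching i P? = trans (sum-cong-≗ {M} λ j → trans (⟦⟧-× (suc (toℕ i + toℕ j) ℕ.≟ M) P?)
      (cong (_* ⟦ P? ⟧) (⟦⟧-cong (suc (toℕ i + toℕ j) ℕ.≟ M) (opposite i ≟ j) (matched⇒opposite j) opposite⇒matched)))
    (∑-single {M} (λ _ → ⟦ P? ⟧) (opposite i))
    where
    matched⇒opposite : ∀ j → suc (toℕ i + toℕ j) ≡ M → opposite i ≡ j
    matched⇒opposite j eq = toℕ-injective (begin
      toℕ (opposite i)                 ≡⟨ opposite-prop i ⟩
      M ∸ suc (toℕ i)                  ≡⟨ cong (_∸ suc (toℕ i)) (sym eq) ⟩
      suc (toℕ i) + toℕ j ∸ suc (toℕ i) ≡⟨ ℕ.m+n∸m≡n (suc (toℕ i)) (toℕ j) ⟩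
      toℕ j                            ∎)

    opposite⇒matched : ∀ {j} → opposite i ≡ j → suc (toℕ i + toℕ j) ≡ M
    opposite⇒matched refl = trans (cong (suc (toℕ i) +_) (opposite-prop i)) (ℕ.m+[n∸m]≡n (toℕ<n i))

  ∑-removed-row : ∀ i → ∑ (λ j → ⟦ removed? i j ⟧) ≡ ⟦ toℕ i <? c ⟧
  ∑-removed-row i = ∑-matching i (toℕ i <? c)

  ∑-removed-column : ∀ j → ∑ (λ i → ⟦ removed? i j ⟧) ≡ ⟦ M ≤? toℕ j + c ⟧
  ∑-removed-column j = trans
    (sum-cong-≗ λ i → ⟦⟧-cong (removed? i j) ((suc (toℕ j + toℕ i) ℕ.≟ M) ×-dec (M ≤? toℕ j + c)) (there i) (back i))
    (∑-matching j (M ≤? toℕ j + c))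
    where
    there : ∀ i → Removed i j → suc (toℕ j + toℕ i) ≡ M × M ≤ toℕ j + c
    there i (eq , i<c) = eq′ , subst (_≤ toℕ j + c) (trans (ℕ.+-suc (toℕ j) (toℕ i)) eq′) (ℕ.+-monoʳ-≤ (toℕ j) i<c)
      where eq′ = trans (cong suc (ℕ.+-comm (toℕ j) (toℕ i))) eq

    back : ∀ i → suc (toℕ j + toℕ i) ≡ M × M ≤ toℕ j + c → Removed i j
    back i (eq , M≤j+c) = trans (cong suc (ℕ.+-comm (toℕ i) (toℕ j))) eq ,
      ℕ.+-cancelˡ-≤ (toℕ j) _ _ (subst (_≤ toℕ j + c) (sym (trans (ℕ.+-suc (toℕ j) (toℕ i)) eq)) M≤j+c)

  link+removed : ∀ i j → ⟦ link? i j ⟧ + ⟦ removed? i j ⟧ ≡ ⟦ circulant? i j ⟧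
  link+removed i j = ⟦⟧-∖ (circulant? i j) (removed? i j)
    λ (eq , _) → subst (_< d) (sym (trans (cong (_% M) eq) (n%n≡0 M))) 0<d

  -- Either there is exactly one apex, or nothing is removed and both sides are 0. Thus the apex
  -- edges at a vertex match its removed edges in number.
  ∑-apex : ∀ {P : Set} (P? : Dec P) → (c ≡ 0 → ¬ P) → ∑ {e} (λ _ → ⟦ P? ⟧) ≡ ⟦ P? ⟧
  ∑-apex P? ¬P = trans (∑-const e ⟦ P? ⟧) (go e-or-c P?)
    where
    go : e ≡ 1 ⊎ c ≡ 0 → ∀ P? → e * ⟦ P? ⟧ ≡ ⟦ P? ⟧
    go (inj₁ refl) P?      = ℕ.*-identityˡ ⟦ P? ⟧
    go (inj₂ c≡0)  (no _)  = ℕ.*-zeroʳ e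
    go (inj₂ c≡0)  (yes p) = contradiction p (¬P c≡0)

  ∑-edges : Vertex → ℕ
  ∑-edges u = ∑ (λ v → ⟦ edge? u (vertex v) ⟧)

  ∑-zero : ∀ n → ∑ {n} (λ _ → 0) ≡ 0
  ∑-zero n = trans (∑-const n 0) (ℕ.*-zeroʳ n)

  -- The apex edges make up for the removed matching edges, so the circulant degree is restored.
  ∑-edges-left : ∀ i → ∑-edges (left i) ≡ d
  ∑-edges-left i = begin
    ∑-edges (left i)
      ≡⟨ ∑-vertex (λ v → ⟦ edge? (left i) v ⟧) ⟩
    ∑ {M} (λ _ → 0) + (∑ (λ j → ⟦ link? i j ⟧) + ∑ {e} (λ _ → ⟦ toℕ i <? c ⟧))
      ≡⟨ cong₂ (λ x y → x + (∑ (λ j → ⟦ link? i j ⟧) + y)) (∑-zero M)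
           (trans (∑-apex (toℕ i <? c) λ { refl () }) (sym (∑-removed-row i))) ⟩
    ∑ (λ j → ⟦ link? i j ⟧) + ∑ (λ j → ⟦ removed? i j ⟧)
      ≡⟨ sym (∑-distrib-+ (λ j → ⟦ link? i j ⟧) (λ j → ⟦ removed? i j ⟧)) ⟩
    ∑ (λ j → ⟦ link? i j ⟧ + ⟦ removed? i j ⟧)
      ≡⟨ sum-cong-≗ (link+removed i) ⟩
    ∑ (λ j → ⟦ circulant? i j ⟧)
      ≡⟨ ∑-circulant i ⟩
    d ∎

  ∑-edges-right : ∀ j → ∑-edges (right j) ≡ d
  ∑-edges-right j = begin
    ∑-edges (right j)
      ≡⟨ ∑-vertex (λ v → ⟦ edge? (right j) v ⟧) ⟩
    ∑ (λ i → ⟦ link? i j ⟧) + (∑ {M} (λ _ → 0) + ∑ {e} (λ _ → ⟦ M ≤? toℕ j + c ⟧))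
      ≡⟨ cong₂ (λ x y → ∑ (λ i → ⟦ link? i j ⟧) + (x + y)) (∑-zero M)
           (trans (∑-apex (M ≤? toℕ j + c) beyond) (sym (∑-removed-column j))) ⟩
    ∑ (λ i → ⟦ link? i j ⟧) + ∑ (λ i → ⟦ removed? i j ⟧)
      ≡⟨ sym (∑-distrib-+ (λ i → ⟦ link? i j ⟧) (λ i → ⟦ removed? i j ⟧)) ⟩
    ∑ (λ i → ⟦ link? i j ⟧ + ⟦ removed? i j ⟧)
      ≡⟨ sum-cong-≗ (λ i → link+removed i j) ⟩
    ∑ (λ i → ⟦ circulant? i j ⟧)
      ≡⟨ sum-cong-≗ {M} (λ i → cong (λ s → ⟦ suc s % M <? d ⟧) (ℕ.+-comm (toℕ i) (toℕ j))) ⟩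
    ∑ (λ i → ⟦ circulant? j i ⟧)
      ≡⟨ ∑-circulant j ⟩
    d ∎
    where
    beyond : c ≡ 0 → ¬ M ≤ toℕ j + c
    beyond refl M≤j = ℕ.<⇒≱ (toℕ<n j) (subst (M ≤_) (ℕ.+-identityʳ (toℕ j)) M≤j)

  ∑-edges-apex : ∀ x → ∑-edges (apex x) ≡ 2 * c
  ∑-edges-apex x = begin
    ∑-edges (apex x)
      ≡⟨ ∑-vertex (λ v → ⟦ edge? (apex x) v ⟧) ⟩
    ∑ {M} (λ i → ⟦ toℕ i <? c ⟧) + (∑ {M} (λ j → ⟦ M ≤? toℕ j + c ⟧) + ∑ {e} (λ _ → 0))
      ≡⟨ cong₂ _+_ (∑-<? c≤M) (cong₂ _+_ right-ends (∑-zero e)) ⟩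
    2 * c ∎
    where
    -- Double counting of the removed edges: by columns they give the right ends, by rows the left
    -- ends.
    right-ends : ∑ {M} (λ j → ⟦ M ≤? toℕ j + c ⟧) ≡ c
    right-ends = begin
      ∑ {M} (λ j → ⟦ M ≤? toℕ j + c ⟧)        ≡⟨ sum-cong-≗ (λ j → sym (∑-removed-column j)) ⟩
      ∑ (λ j → ∑ (λ i → ⟦ removed? i j ⟧))    ≡⟨ ∑-comm (λ j i → ⟦ removed? i j ⟧) ⟩
      ∑ (λ i → ∑ (λ j → ⟦ removed? i j ⟧))    ≡⟨ sum-cong-≗ ∑-removed-row ⟩
      ∑ {M} (λ i → ⟦ toℕ i <? c ⟧)            ≡⟨ ∑-<? c≤M ⟩
      c                                       ∎

  Λ-G : Λ H G ≡ M * weight (M + (M + e)) d + (M * weight (M + (M + e)) d + e * weight (M + (M + e)) (2 * c))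
  Λ-G = begin
    Λ H G
      ≡⟨ Λ-∑ G ⟩
    ∑ (λ v → w (degree G v))
      ≡⟨ sum-cong-≗ (λ v → cong w (degree-∑ G v)) ⟩
    ∑ (λ v → w (∑-edges (vertex v)))
      ≡⟨ ∑-vertex (w ∘ ∑-edges) ⟩
    ∑ (λ i → w (∑-edges (left i))) + (∑ (λ j → w (∑-edges (right j))) + ∑ (λ x → w (∑-edges (apex x))))
      ≡⟨ cong₂ _+_ (sum-cong-≗ (cong w ∘ ∑-edges-left))
           (cong₂ _+_ (sum-cong-≗ (cong w ∘ ∑-edges-right)) (sum-cong-≗ (cong w ∘ ∑-edges-apex))) ⟩
    ∑ {M} (λ _ → w d) + (∑ {M} (λ _ → w d) + ∑ {e} (λ _ → w (2 * c)))
      ≡⟨ cong₂ _+_ (∑-const M _) (cong₂ _+_ (∑-const M _) (∑-const e _)) ⟩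
    M * w d + (M * w d + e * w (2 * c)) ∎
    where
    w : ℕ → ℕ
    w = weight (M + (M + e))

-- Extremal degree sequences

∑-mono-≤ : ∀ {n} {f g : Fin n → ℕ} → (∀ i → f i ≤ g i) → ∑ f ≤ ∑ g
∑-mono-≤ {zero}  f≤g = z≤n
∑-mono-≤ {suc n} f≤g = ℕ.+-mono-≤ (f≤g zero) (∑-mono-≤ (f≤g ∘ suc))

∑-≤-const : ∀ {n V} {f : Fin n → ℕ} → (∀ i → f i ≤ V) → ∑ f ≤ n * V
∑-≤-const {n} {V} {f} f≤V = subst (∑ f ≤_) (∑-const n V) (∑-mono-≤ f≤V)

∑-≡-const : ∀ {n V} {f : Fin n → ℕ} → (∀ i → f i ≤ V) → ∑ f ≡ n * V → ∀ i → f i ≡ V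
∑-≡-const {suc n} {V} {f} f≤V eq = go
  where
  rest≤ : ∑ (f ∘ suc) ≤ n * V
  rest≤ = ∑-≤-const (f≤V ∘ suc)

  head≡ : f zero ≡ V
  head≡ = ℕ.≤-antisym (f≤V zero) (ℕ.+-cancelʳ-≤ (n * V) _ _
    (subst (_≤ f zero + n * V) eq (ℕ.+-monoʳ-≤ (f zero) rest≤)))

  go : ∀ i → f i ≡ V
  go zero    = head≡
  go (suc i) = ∑-≡-const (f≤V ∘ suc) (ℕ.+-cancelˡ-≡ V _ _ (subst (λ x → x + ∑ (f ∘ suc) ≡ V + n * V) head≡ eq)) i

∑-≡0 : ∀ {n} {f : Fin n → ℕ} → ∑ f ≡ 0 → ∀ i → f i ≡ 0
∑-≡0 {suc n} {f} eq zero    = ℕ.m+n≡0⇒m≡0 (f zero) eq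
∑-≡0 {suc n} {f} eq (suc i) = ∑-≡0 (ℕ.m+n≡0⇒n≡0 (f zero) eq) i

Λmax-≡ : ∀ {h n V} (K : ColouredGraph h) → (∀ (G : Graph n) → Λ K G ≤ V) → (∃ λ (G : Graph n) → Λ K G ≡ V) → Λmax K n ≡ V
Λmax-≡ {n = n} K bound (G , ΛG≡V) = ℕ.≤-antisym
  (let (G′ , eq) = IsMaximum.attained (Λmax-isMaximum K n) in subst (_≤ _) eq (bound G′))
  (subst (_≤ Λmax K n) ΛG≡V (IsMaximum.upperBound (Λmax-isMaximum K n) G))

construct : ∀ {n} M d c e → n ≡ M + (M + e) → 0 < d → d ≤ M → c ≤ M → e ≡ 1 ⊎ c ≡ 0 →
  ∃ λ (G : Graph n) → Λ H G ≡ M * weight n d + (M * weight n d + e * weight n (2 * c))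
construct M d c e refl 0<d d≤M c≤M e-or-c = Built.G , Built.Λ-G
  where module Built = Construction M d c e {{>-nonZero (ℕ.<-≤-trans 0<d d≤M)}} 0<d d≤M c≤M e-or-c

private
  collect : ∀ M e w → M * w + (M * w + e * w) ≡ (M + (M + e)) * w
  collect = solve-∀

construct-even : ∀ {n} M d → n ≡ M + M → 0 < d → d ≤ M → ∃ λ (G : Graph n) → Λ H G ≡ n * weight n d
construct-even {n} M d n≡ 0<d d≤M = G , trans eq (trans (collect M 0 (weight n d)) (cong (_* weight n d) (sym n≡′)))
  where
  n≡′ : n ≡ M + (M + 0)
  n≡′ = trans n≡ (cong (M +_) (sym (ℕ.+-identityʳ M)))
  built = construct M d 0 0 n≡′ 0<d d≤M z≤n (inj₂ refl)
  G = proj₁ built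
  eq = proj₂ built

-- The choice d = 2c gives the apex the same degree as all other vertices.
construct-odd : ∀ {n} M d c → n ≡ M + (M + 1) → 0 < d → d ≤ M → c ≤ M → 2 * c ≡ d →
  ∃ λ (G : Graph n) → Λ H G ≡ n * weight n d
construct-odd {n} M d c n≡ 0<d d≤M c≤M refl =
  let (G , eq) = construct M d c 1 n≡ 0<d d≤M c≤M (inj₁ refl)
  in G , trans eq (trans (collect M 1 (weight n d)) (cong (_* weight n d) (sym n≡)))

-- Once some graph meets the pointwise bound at every vertex, a graph is extremal exactly when no
-- vertex loses anything.
maximal-degrees : ∀ {n V} {Good : ℕ → Set} → (∀ d → weight n d ≤ V) → (∀ d → weight n d ≡ V ⇔ Good d) →
  (∃ λ (G : Graph n) → Λ H G ≡ n * V) →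
  Λmax H n ≡ n * V × (∀ (G : Graph n) → (Λ H G ≡ Λmax H n) ⇔ (∀ v → Good (degree G v)))
maximal-degrees {n} {V} {Good} bound extremal attained = Λmax≡ , λ G → mk⇔
    (λ eq v → Equivalence.to (extremal _)
      (∑-≡-const (λ v → bound (degree G v)) (trans (sym (Λ-∑ G)) (trans eq Λmax≡)) v))
    (λ good → trans (Λ-∑ G) (trans (sum-cong-≗ λ v → Equivalence.from (extremal _) (good v))
      (trans (∑-const n V) (sym Λmax≡))))
  where
  Λmax≡ : Λmax H n ≡ n * V
  Λmax≡ = Λmax-≡ H (λ G → subst (_≤ n * V) (sym (Λ-∑ G)) (∑-≤-const (λ v → bound (degree G v)))) attained

-- The strict bounds on n keep the factor n - 3 - 3d of the increment from vanishing; 3 + t ≤ n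
-- keeps n - 2 - t positive.
weight-peak : ∀ {n} t → 3 * t < n → n < 3 * suc t → 3 + t ≤ n → ∀ d → weight n d ≤ weight n t × (weight n d ≡ weight n t ⇔ d ≡ t)
weight-peak {n} t 3t<n n<3+3t 3+t≤n d with ℕ.<-cmp d t
... | tri< d<t d≢t _ = let lt = weight-mono-< 3t<n d<t in
  ℕ.<⇒≤ lt , mk⇔ (λ eq → contradiction eq (ℕ.<⇒≢ lt)) (λ eq → contradiction eq d≢t)
... | tri≈ _ d≡t _   = ℕ.≤-reflexive (cong (weight n) d≡t) , mk⇔ (λ _ → d≡t) (cong (weight n))
... | tri> _ d≢t t<d = let lt = weight-anti-< n<3+3t 3+t≤n t<d in
  ℕ.<⇒≤ lt , mk⇔ (λ eq → contradiction eq (ℕ.<⇒≢ lt)) (λ eq → contradiction eq d≢t)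

private
  plateau-room : ∀ {t} → 0 < t → 4 + t ≤ 3 * suc t
  plateau-room {suc s} _ = subst (5 + s ≤_) (lemma s) (ℕ.m≤m+n (5 + s) (1 + 2 * s))
    where
    lemma : ∀ s → 5 + s + (1 + 2 * s) ≡ 3 * (2 + s)
    lemma = solve-∀

-- The increment from `t` to `suc t` has the factor n - 3 - 3t = 0. Positivity of `t` leaves room
-- for a strict drop after `suc t`. The variable `u` lets callers write `suc t` in their own form.
weight-plateau : ∀ {n} t u → 0 < t → n ≡ 3 * suc t → u ≡ suc t →
  ∀ d → weight n d ≤ weight n t × (weight n d ≡ weight n t ⇔ (d ≡ t ⊎ d ≡ u))
weight-plateau {n} t u 0<t refl refl d = by-cases (ℕ.<-cmp d t) (ℕ.<-cmp d (suc t))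
  where
  level : weight n (suc t) ≡ weight n t
  level = trans (weight-rising t 0 (sym (ℕ.+-identityʳ n)))
    (trans (cong (weight n t +_) (ℕ.*-zeroʳ (suc (2 * t + 0)))) (ℕ.+-identityʳ _))

  Claim : Set
  Claim = weight n d ≤ weight n t × (weight n d ≡ weight n t ⇔ (d ≡ t ⊎ d ≡ suc t))

  lower : weight n d < weight n t → d ≢ t → d ≢ suc t → Claim
  lower lt d≢t d≢u = ℕ.<⇒≤ lt , mk⇔ (λ eq → contradiction eq (ℕ.<⇒≢ lt))
    λ { (inj₁ d≡t) → contradiction d≡t d≢t ; (inj₂ d≡u) → contradiction d≡u d≢u }

  equal : weight n d ≡ weight n t → d ≡ t ⊎ d ≡ suc t → Claim
  equal eq d∈ = ℕ.≤-reflexive eq , mk⇔ (λ _ → d∈) (λ _ → eq)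

  by-cases : _ → _ → Claim
  by-cases (tri≈ _ d≡t _) _ = equal (cong (weight n) d≡t) (inj₁ d≡t)
  by-cases _ (tri≈ _ d≡u _) = equal (trans (cong (weight n) d≡u) level) (inj₂ d≡u)
  by-cases (tri< d<t d≢t _) (tri< _ d≢u _) = lower (weight-mono-< (ℕ.*-monoʳ-< 3 (ℕ.n<1+n t)) d<t) d≢t d≢u
  by-cases (tri> _ d≢t t<d) (tri> _ d≢u u<d) = lower
    (subst (weight n d <_) level (weight-anti-< (ℕ.*-monoʳ-< 3 (ℕ.n<1+n (suc t))) (plateau-room 0<t) u<d)) d≢t d≢u
  by-cases (tri< d<t _ _) (tri> _ _ u<d) = contradiction (ℕ.<-trans d<t (ℕ.n<1+n t)) (ℕ.<-asym u<d)
  by-cases (tri> _ _ t<d) (tri< d<u _ _) = contradiction t<d (ℕ.≤⇒≯ (s≤s⁻¹ d<u))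

-- Costs of the degrees off the peak when n is 2 modulo 3

module _ {n} (s : ℕ) (n≡ : n ≡ 3 * suc s + 2) where

  private
    t loss : ℕ
    t    = suc s
    loss = 2 * t

  weight-near-peak : weight n t ≡ weight n (suc t) + loss
  weight-near-peak = trans (weight-falling t (1 + 2 * s) 1 (trans n≡ (size s)) (gap s)) (cong (weight n (suc t) +_) (value s))
    where
    size : ∀ s → 3 * suc s + 2 ≡ 3 + (1 + 2 * s) + suc s
    size = solve-∀
    gap : ∀ s → 1 + 2 * s + 1 ≡ 2 * suc s
    gap = solve-∀
    value : ∀ s → suc (1 + 2 * s) * 1 ≡ 2 * suc s
    value = solve-∀

  weight-before-peak : weight n s + suc loss ≤ weight n t
  weight-before-peak = subst (weight n s + suc loss ≤_)
    (sym (trans (weight-rising s 2 n≡) (cong (weight n s +_) (value s))))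
    (ℕ.+-monoʳ-≤ (weight n s) (ℕ.m≤m+n (suc loss) (3 + 2 * s)))
    where
    value : ∀ s → suc (2 * s + 2) * 2 ≡ suc (2 * suc s) + (3 + 2 * s)
    value = solve-∀

  private
    room : 4 + t ≤ n
    room = subst (4 + t ≤_) (trans (lemma s) (sym n≡)) (ℕ.m≤m+n (4 + t) (2 * s))
      where
      lemma : ∀ s → 4 + suc s + 2 * s ≡ 3 * suc s + 2
      lemma = solve-∀

    n<6+3t : n < 3 * suc (suc t)
    n<6+3t = subst (n <_) (trans (cong (_+ 4) n≡) (lemma t)) (ℕ.m<m+n n (s≤s z≤n))
      where
      lemma : ∀ t → 3 * t + 2 + 4 ≡ 3 * suc (suc t)
      lemma = solve-∀

  -- Degree t + 1 is the unique cheapest deviation, with cost 2t: degree t - 1 already costs 4t + 2,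
  -- and from t + 2 onwards the weight is strictly below its value at t + 1.
  weight-off-peak : ∀ {d} → d ≢ t → d ≢ suc t → weight n d + suc loss ≤ weight n t
  weight-off-peak {d} d≢t d≢1+t with ℕ.<-cmp d t
  ... | tri< d<t _ _ = ℕ.≤-trans (ℕ.+-monoˡ-≤ (suc loss)
        (weight-mono-≤ (subst (3 * s ≤_) (sym n≡) (ℕ.≤-trans (ℕ.*-monoʳ-≤ 3 (ℕ.n≤1+n s)) (ℕ.m≤m+n (3 * t) 2))) (s≤s⁻¹ d<t)))
        weight-before-peak
  ... | tri≈ _ d≡t _ = contradiction d≡t d≢t
  ... | tri> _ _ t<d = subst₂ _≤_ (sym (ℕ.+-suc (weight n d) loss)) (sym weight-near-peak)
        (ℕ.+-monoˡ-≤ loss (weight-anti-< n<6+3t room (ℕ.≤∧≢⇒< t<d (d≢1+t ∘ sym))))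

-- Accounting by cost: degree t is free, degree t + 1 costs `loss`, any other degree costs more, and
-- parity forbids a graph in which every vertex is free.
module NearPeak {n t loss : ℕ} .{{_ : NonZero loss}} (0<n : 0 < n)
  (weight-1+t : weight n t ≡ weight n (suc t) + loss)
  (weight-other : ∀ {d} → d ≢ t → d ≢ suc t → weight n d + suc loss ≤ weight n t)
  (odd : ¬ 2 ∣ n * t) where

  other? : ∀ d → Dec (d ≢ t × d ≢ suc t)
  other? d = ¬? (d ℕ.≟ t) ×-dec ¬? (d ℕ.≟ suc t)

  -- The upper estimate charges the least cost `suc loss` to an unusual degree, the lower one the
  -- crude cost `weight n t`; the latter is evaluated only when no unusual degree occurs. The last
  -- component says that the three classes partition the degrees.
  weight+loss : ∀ d →
      weight n d + (loss * ⟦ d ℕ.≟ suc t ⟧ + suc loss * ⟦ other? d ⟧) ≤ weight n t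
    × weight n t ≤ weight n d + (loss * ⟦ d ℕ.≟ suc t ⟧ + weight n t * ⟦ other? d ⟧)
    × ⟦ d ℕ.≟ t ⟧ + (⟦ d ℕ.≟ suc t ⟧ + ⟦ other? d ⟧) ≡ 1
  weight+loss d = go (d ℕ.≟ t) (d ℕ.≟ suc t)
    where
    none : ∀ x l m → x + (l * 0 + m * 0) ≡ x
    none = solve-∀
    first : ∀ x l m → x + (l * 1 + m * 0) ≡ x + l
    first = solve-∀
    second : ∀ x l m → x + (l * 0 + m * 1) ≡ x + m
    second = solve-∀

    go : (P? : Dec (d ≡ t)) (Q? : Dec (d ≡ suc t)) →
        weight n d + (loss * ⟦ Q? ⟧ + suc loss * ⟦ ¬? P? ×-dec ¬? Q? ⟧) ≤ weight n t
      × weight n t ≤ weight n d + (loss * ⟦ Q? ⟧ + weight n t * ⟦ ¬? P? ×-dec ¬? Q? ⟧)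
      × ⟦ P? ⟧ + (⟦ Q? ⟧ + ⟦ ¬? P? ×-dec ¬? Q? ⟧) ≡ 1
    go (yes d≡t) (yes d≡1+t) = contradiction (trans (sym d≡t) d≡1+t) (ℕ.<⇒≢ (ℕ.n<1+n t))
    go (yes refl) (no _)     = ℕ.≤-reflexive (none (weight n t) loss (suc loss))
                             , ℕ.≤-reflexive (sym (none (weight n t) loss (weight n t))) , refl
    go (no _) (yes refl)     = ℕ.≤-reflexive (trans (first (weight n (suc t)) loss (suc loss)) (sym weight-1+t))
                             , ℕ.≤-reflexive (trans weight-1+t (sym (first (weight n (suc t)) loss (weight n t)))) , refl
    go (no d≢t) (no d≢1+t)   = subst (_≤ weight n t) (sym (second (weight n d) loss (suc loss))) (weight-other d≢t d≢1+t)
                             , subst (weight n t ≤_) (sym (second (weight n d) loss (weight n t))) (ℕ.m≤n+m _ _) , refl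

  module _ (G : Graph n) where

    #others : ℕ
    #others = ∑ (λ v → ⟦ other? (degree G v) ⟧)

    #degree-∑ : ∀ x → #degree≡ G x ≡ ∑ (λ v → ⟦ degree G v ℕ.≟ x ⟧)
    #degree-∑ x = length-filter-tabulate (λ v → degree G v ℕ.≟ x) id

    ∑-weight+loss : ∀ m → ∑ (λ v → weight n (degree G v) +
        (loss * ⟦ degree G v ℕ.≟ suc t ⟧ + m * ⟦ other? (degree G v) ⟧))
      ≡ Λ H G + (loss * #degree≡ G (suc t) + m * #others)
    ∑-weight+loss m = trans (∑-distrib-+ {n} (λ v → weight n (degree G v)) _)
      (cong₂ _+_ (sym (Λ-∑ G)) (trans (∑-distrib-+ {n} (λ v → loss * ⟦ degree G v ℕ.≟ suc t ⟧) _)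
        (cong₂ _+_ (trans (sym (*-distribˡ-sum {n} loss _)) (cong (loss *_) (sym (#degree-∑ (suc t)))))
                   (sym (*-distribˡ-sum {n} m _)))))

    Λ-upper : Λ H G + (loss * #degree≡ G (suc t) + suc loss * #others) ≤ n * weight n t
    Λ-upper = subst (_≤ n * weight n t) (∑-weight+loss (suc loss)) (∑-≤-const (proj₁ ∘ weight+loss ∘ degree G))

    Λ-lower : n * weight n t ≤ Λ H G + (loss * #degree≡ G (suc t) + weight n t * #others)
    Λ-lower = subst₂ _≤_ (∑-const n (weight n t)) (∑-weight+loss (weight n t))
      (∑-mono-≤ (proj₁ ∘ proj₂ ∘ weight+loss ∘ degree G))

    #degrees : #degree≡ G t + (#degree≡ G (suc t) + #others) ≡ n
    #degrees = begin
      #degree≡ G t + (#degree≡ G (suc t) + #others)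
        ≡⟨ cong₂ (λ x y → x + (y + #others)) (#degree-∑ t) (#degree-∑ (suc t)) ⟩
      ∑ (λ v → ⟦ degree G v ℕ.≟ t ⟧) + (∑ (λ v → ⟦ degree G v ℕ.≟ suc t ⟧) + #others)
        ≡⟨ cong (∑ (λ v → ⟦ degree G v ℕ.≟ t ⟧) +_) (sym (∑-distrib-+ {n} (λ v → ⟦ degree G v ℕ.≟ suc t ⟧) _)) ⟩
      ∑ (λ v → ⟦ degree G v ℕ.≟ t ⟧) + ∑ (λ v → ⟦ degree G v ℕ.≟ suc t ⟧ + ⟦ other? (degree G v) ⟧)
        ≡⟨ sym (∑-distrib-+ {n} (λ v → ⟦ degree G v ℕ.≟ t ⟧) _) ⟩
      ∑ (λ v → ⟦ degree G v ℕ.≟ t ⟧ + (⟦ degree G v ℕ.≟ suc t ⟧ + ⟦ other? (degree G v) ⟧))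
        ≡⟨ sum-cong-≗ {n} (proj₂ ∘ proj₂ ∘ weight+loss ∘ degree G) ⟩
      ∑ {n} (λ _ → 1)
        ≡⟨ trans (∑-const n 1) (ℕ.*-identityʳ n) ⟩
      n ∎
      where open ≡-Reasoning

    all-degree-t : #degree≡ G (suc t) + #others ≡ 0 → ∀ v → degree G v ≡ t
    all-degree-t eq v = go (degree G v ℕ.≟ t) (degree G v ℕ.≟ suc t)
      where
      go : Dec (degree G v ≡ t) → Dec (degree G v ≡ suc t) → degree G v ≡ t
      go (yes d≡t) _          = d≡t
      go (no _) (yes d≡1+t)   = contradiction (trans (sym (⟦⟧-yes (degree G v ℕ.≟ suc t) d≡1+t))
        (∑-≡0 {n} (trans (sym (#degree-∑ (suc t))) (ℕ.m+n≡0⇒m≡0 _ eq)) v)) λ ()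
      go (no d≢t) (no d≢1+t)  = contradiction (trans (sym (⟦⟧-yes (other? (degree G v)) (d≢t , d≢1+t)))
        (∑-≡0 {n} (ℕ.m+n≡0⇒n≡0 (#degree≡ G (suc t)) eq) v)) λ ()

    -- Otherwise the graph is t-regular and n t is its degree sum, which is even.
    exceptional : 0 < #degree≡ G (suc t) + #others
    exceptional = ℕ.n≢0⇒n>0 λ eq →
      let (e , ∑≡2e) = handshake G
      in odd (divides e (trans (sym (∑-const n t))
           (trans (sum-cong-≗ {n} (λ v → sym (all-degree-t eq v))) (trans ∑≡2e (ℕ.*-comm 2 e)))))

    Λ-bound : Λ H G + loss ≤ n * weight n t
    Λ-bound = ℕ.≤-trans (ℕ.+-monoʳ-≤ (Λ H G) (begin
      loss                                                ≡⟨ sym (ℕ.*-identityʳ loss) ⟩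
      loss * 1                                            ≤⟨ ℕ.*-monoʳ-≤ loss (exceptional) ⟩
      loss * (#degree≡ G (suc t) + #others)               ≡⟨ ℕ.*-distribˡ-+ loss _ #others ⟩
      loss * #degree≡ G (suc t) + loss * #others          ≤⟨ ℕ.+-monoʳ-≤ _ (ℕ.m≤n+m (loss * #others) #others) ⟩
      loss * #degree≡ G (suc t) + suc loss * #others      ∎)) Λ-upper
      where open ℕ.≤-Reasoning

    -- Equality leaves a budget of one `loss`. At least one exceptional vertex spends it, so there
    -- is no surplus for an unusual degree and none for a second vertex of degree t + 1.
    extremal⇒degrees : Λ H G + loss ≡ n * weight n t → #degree≡ G t ≡ n ∸ 1 × #degree≡ G (suc t) ≡ 1
    extremal⇒degrees eq = C₀≡n∸1 , C₁≡1
      where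
      C₁ = #degree≡ G (suc t)
      open ℕ.≤-Reasoning

      total≤loss : loss * (C₁ + #others) + #others ≤ loss
      total≤loss = ℕ.+-cancelˡ-≤ (Λ H G) _ _ (begin
        Λ H G + (loss * (C₁ + #others) + #others)      ≡⟨ cong (Λ H G +_) (regroup loss C₁ #others) ⟩
        Λ H G + (loss * C₁ + suc loss * #others)       ≤⟨ Λ-upper ⟩
        n * weight n t                                 ≡⟨ sym eq ⟩
        Λ H G + loss                                   ∎)
        where
        regroup : ∀ l x y → l * (x + y) + y ≡ l * x + suc l * y
        regroup = solve-∀

      others≡0 : #others ≡ 0
      others≡0 = ℕ.n≤0⇒n≡0 (ℕ.+-cancelˡ-≤ loss _ _ (begin
        loss + #others                       ≡⟨ cong (_+ #others) (sym (ℕ.*-identityʳ loss)) ⟩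
        loss * 1 + #others                   ≤⟨ ℕ.+-monoˡ-≤ #others (ℕ.*-monoʳ-≤ loss (exceptional)) ⟩
        loss * (C₁ + #others) + #others      ≤⟨ total≤loss ⟩
        loss                                 ≡⟨ sym (ℕ.+-identityʳ loss) ⟩
        loss + 0                             ∎))

      C₁≡C₁+others : C₁ + #others ≡ C₁
      C₁≡C₁+others = trans (cong (C₁ +_) others≡0) (ℕ.+-identityʳ C₁)

      C₁≡1 : C₁ ≡ 1
      C₁≡1 = ℕ.≤-antisym
        (ℕ.*-cancelˡ-≤ loss (begin
          loss * C₁                        ≡⟨ cong (loss *_) (sym C₁≡C₁+others) ⟩
          loss * (C₁ + #others)            ≤⟨ ℕ.m≤m+n _ #others ⟩
          loss * (C₁ + #others) + #others  ≤⟨ total≤loss ⟩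
          loss                             ≡⟨ sym (ℕ.*-identityʳ loss) ⟩
          loss * 1                         ∎))
        (subst (0 <_) C₁≡C₁+others (exceptional))

      C₀≡n∸1 : #degree≡ G t ≡ n ∸ 1
      C₀≡n∸1 = trans (sym (ℕ.m+n∸n≡m (#degree≡ G t) 1))
        (cong (_∸ 1) (trans (cong (#degree≡ G t +_) (sym (trans C₁≡C₁+others C₁≡1))) #degrees))

    degrees⇒extremal : #degree≡ G t ≡ n ∸ 1 → #degree≡ G (suc t) ≡ 1 → Λ H G + loss ≡ n * weight n t
    degrees⇒extremal C₀≡n∸1 C₁≡1 = ℕ.≤-antisym (Λ-bound) (subst (n * weight n t ≤_)
      (cong (Λ H G +_) (trans (cong₂ (λ x y → loss * x + weight n t * y) C₁≡1 others≡0)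
        (only loss (weight n t)))) Λ-lower)
      where
      only : ∀ l m → l * 1 + m * 0 ≡ l
      only = solve-∀

      others≡0 : #others ≡ 0
      others≡0 = ℕ.suc-injective (ℕ.+-cancelˡ-≡ (n ∸ 1) _ _ (begin
        n ∸ 1 + suc #others                            ≡⟨ cong₂ (λ x y → x + (y + #others)) (sym C₀≡n∸1) (sym C₁≡1) ⟩
        #degree≡ G t + (#degree≡ G (suc t) + #others)  ≡⟨ #degrees ⟩
        n                                              ≡⟨ sym (ℕ.m∸n+n≡m {n} {1} 0<n) ⟩
        n ∸ 1 + 1                                      ∎))
        where open ≡-Reasoning

-- From natural numbers to ℚ

open import Data.Integer using (+_)

÷1≡÷2 : ∀ a b → 2 * a ≡ b → + a ÷ 1 ≡ + b ÷ 2
÷1≡÷2 a _ refl = ℚ.fromℚᵘ-cong {mkℚᵘ (+ a) 0} {mkℚᵘ (+ (2 * a)) 1} (*≡* (begin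
  + a ℤ.* + 2       ≡⟨ ℤ.*-comm (+ a) (+ 2) ⟩
  + 2 ℤ.* + a       ≡⟨ sym (ℤ.pos-* 2 a) ⟩
  + (2 * a)         ≡⟨ sym (ℤ.*-identityʳ (+ (2 * a))) ⟩
  + (2 * a) ℤ.* + 1 ∎))
  where open ≡-Reasoning

-- The hypothesis is the identity with denominators cleared and the subtraction moved across.
-- Rationals are normalised, so the proof passes to unnormalised fractions, where equality is cross
-- multiplication.
÷1≡÷2-÷ : ∀ a b c q .{{_ : NonZero q}} → 2 * (a * q + c) ≡ b * q → + a ÷ 1 ≡ + b ÷ 2 - + c ÷ q
÷1≡÷2-÷ a b c q@(suc q-1) eq = ℚ.toℚᵘ-injective (begin
  toℚᵘ (+ a ÷ 1)                         ≈⟨ ℚ.toℚᵘ-fromℚᵘ (mkℚᵘ (+ a) 0) ⟩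
  mkℚᵘ (+ a) 0                             ≈⟨ *≡* cross ⟩
  mkℚᵘ (+ b) 1 ℚᵘ.- mkℚᵘ (+ c) q-1         ≈⟨ ℚᵘ.≃-sym (ℚᵘ.+-cong (ℚ.toℚᵘ-fromℚᵘ (mkℚᵘ (+ b) 1))
                                                (ℚᵘ.-‿cong (ℚ.toℚᵘ-fromℚᵘ (mkℚᵘ (+ c) q-1)))) ⟩
  toℚᵘ (+ b ÷ 2) ℚᵘ.- toℚᵘ (+ c ÷ q)   ≈⟨ ℚᵘ.+-congʳ (toℚᵘ (+ b ÷ 2)) (ℚᵘ.≃-sym (ℚ.toℚᵘ-homo‿- (+ c ÷ q))) ⟩
  toℚᵘ (+ b ÷ 2) ℚᵘ.+ toℚᵘ (ℚ.- (+ c ÷ q)) ≈⟨ ℚᵘ.≃-sym (ℚ.toℚᵘ-homo-+ (+ b ÷ 2) (ℚ.- (+ c ÷ q))) ⟩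
  toℚᵘ (+ b ÷ 2 - + c ÷ q)               ∎)
  where
  open SetoidReasoning ℚᵘ.≃-setoid

  eq-ℤ : + 2 ℤ.* (+ a ℤ.* + q ℤ.+ + c) ≡ + b ℤ.* + q
  eq-ℤ = trans (cong (λ x → + 2 ℤ.* (x ℤ.+ + c)) (sym (ℤ.pos-* a q)))
    (trans (sym (ℤ.pos-* 2 (a * q + c))) (trans (cong +_ eq) (ℤ.pos-* b q)))

  expand : ∀ a q c → a ℤ.* (+ 2 ℤ.* q) ≡ (+ 2 ℤ.* (a ℤ.* q ℤ.+ c) ℤ.+ (ℤ.- c) ℤ.* + 2) ℤ.* + 1
  expand = ℤ-Solver.solve-∀

  cross : + a ℤ.* + (2 * q) ≡ (+ b ℤ.* + q ℤ.+ (ℤ.- + c) ℤ.* + 2) ℤ.* + 1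
  cross = trans (cong (+ a ℤ.*_) (ℤ.pos-* 2 q)) (trans (expand (+ a) (+ q) (+ c))
    (cong (λ x → (x ℤ.+ (ℤ.- + c) ℤ.* + 2) ℤ.* + 1) eq-ℤ))

-- The values of Λ_H(n)

-- The three factors are 2t, m + 1 and m with m = n - 2 - t, and their sum is 3q + r; `δ` measures
-- how far they are from balanced.
twice-weight : ∀ {n t} m q r {δ} → n ≡ 2 + m + t → 2 * n ≡ 3 + (3 * q + r) → 0 < q → r ≤ 3 →
  2 * (t * (suc m * m)) + δ ≡ balancedProduct q r → 2 * weight n t + δ ≡ π₃ (2 * n ∸ 3)
twice-weight {n} {t} m q r {δ} n≡ 2n≡ 0<q r≤3 eq = begin
  2 * weight n t + δ          ≡⟨ cong (λ x → 2 * x + δ) (weight-value m n≡) ⟩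
  2 * (t * (suc m * m)) + δ   ≡⟨ eq ⟩
  balancedProduct q r         ≡⟨ sym (π₃-value q r 0<q r≤3) ⟩
  π₃ (3 * q + r)              ≡⟨ cong (λ x → π₃ (x ∸ 3)) (sym 2n≡) ⟩
  π₃ (2 * n ∸ 3)              ∎
  where open ≡-Reasoning

-- With t = s + 1 the factors are 2t, 2t and 2t - 1: balanced.
twice-weight-1 : ∀ {n} s → n ≡ 3 * suc s + 1 → 2 * weight n (suc s) + 0 ≡ π₃ (2 * n ∸ 3)
twice-weight-1 s n≡ = twice-weight (1 + 2 * s) (1 + 2 * s) 2 (trans n≡ (size s)) (trans (cong (2 *_) n≡) (parts s)) (s≤s z≤n) (s≤s (s≤s z≤n)) (value s)
  where
  size : ∀ s → 3 * suc s + 1 ≡ 2 + (1 + 2 * s) + suc s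
  size = solve-∀
  parts : ∀ s → 2 * (3 * suc s + 1) ≡ 3 + (3 * (1 + 2 * s) + 2)
  parts = solve-∀
  value : ∀ s → 2 * (suc s * (suc (1 + 2 * s) * (1 + 2 * s))) + 0 ≡ (1 + 2 * s) * suc (1 + 2 * s) * suc (1 + 2 * s)
  value = solve-∀

-- With t = s + 1 the factors are 2t, 2t + 1 and 2t: balanced.
twice-weight-2 : ∀ {n} s → n ≡ 3 * suc s + 2 → 2 * weight n (suc s) + 0 ≡ π₃ (2 * n ∸ 3)
twice-weight-2 s n≡ = twice-weight (2 * suc s) (2 * suc s) 1 (trans n≡ (size s)) (trans (cong (2 *_) n≡) (parts s)) (s≤s z≤n) (s≤s z≤n) (value s)
  where
  size : ∀ s → 3 * suc s + 2 ≡ 2 + 2 * suc s + suc s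
  size = solve-∀
  parts : ∀ s → 2 * (3 * suc s + 2) ≡ 3 + (3 * (2 * suc s) + 1)
  parts = solve-∀
  value : ∀ s → 2 * (suc s * (suc (2 * suc s) * (2 * suc s))) + 0 ≡ 2 * suc s * (2 * suc s) * suc (2 * suc s)
  value = solve-∀

-- For q = 2t + 1 the factors are q - 1, q + 1 and q, with product q³ - q, so the deficit is q.
twice-weight-3 : ∀ {n} t → n ≡ 3 * suc t → 2 * weight n t + (1 + 2 * t) ≡ π₃ (2 * n ∸ 3)
twice-weight-3 t n≡ = twice-weight (1 + 2 * t) (1 + 2 * t) 0 (trans n≡ (size t)) (trans (cong (2 *_) n≡) (parts t)) (s≤s z≤n) z≤n (value t)
  where
  size : ∀ t → 3 * suc t ≡ 2 + (1 + 2 * t) + t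
  size = solve-∀
  parts : ∀ t → 2 * (3 * suc t) ≡ 3 + (3 * (1 + 2 * t) + 0)
  parts = solve-∀
  value : ∀ t → 2 * (t * (suc (1 + 2 * t) * (1 + 2 * t))) + (1 + 2 * t) ≡ (1 + 2 * t) * (1 + 2 * t) * (1 + 2 * t)
  value = solve-∀

-- The residue classes modulo 6

third : ∀ t r → r < 3 → (3 * t + r) / 3 ≡ t
third t r r<3 = begin
  (3 * t + r) / 3    ≡⟨ +-distrib-/-∣ˡ {3 * t} r (m∣m*n t) ⟩
  3 * t / 3 + r / 3  ≡⟨ cong₂ _+_ (trans (cong (_/ 3) (ℕ.*-comm 3 t)) (m*n/n≡m t 3)) (m<n⇒m/n≡0 r<3) ⟩
  t + 0              ≡⟨ ℕ.+-identityʳ t ⟩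
  t                  ∎
  where open ≡-Reasoning

private
  peak-room : ∀ s {r} → 0 < r → 3 + suc s ≤ 3 * suc s + r
  peak-room s {suc r} _ = subst (4 + s ≤_) (lemma s r) (ℕ.m≤m+n (4 + s) (2 * s + r))
    where
    lemma : ∀ s r → 4 + s + (2 * s + r) ≡ 3 * suc s + suc r
    lemma = solve-∀

regular-extremal : ∀ {n} t r → n ≡ 3 * suc t + r → 0 < r → r < 3 → 2 * weight n (suc t) + 0 ≡ π₃ (2 * n ∸ 3) →
  (∃ λ (G : Graph n) → Λ H G ≡ n * weight n (suc t)) →
    (+ Λmax H n ÷ 1 ≡ + (n * π₃ (2 * n ∸ 3)) ÷ 2)
  × (∀ (G : Graph n) → (Λ H G ≡ Λmax H n) ⇔ IsRegular G (n / 3))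
regular-extremal {n} s r n≡ 0<r r<3 2w≡π₃ attained =
    ÷1≡÷2 (Λmax H n) (n * π₃ (2 * n ∸ 3)) (begin
      2 * Λmax H n             ≡⟨ cong (2 *_) (proj₁ extremal) ⟩
      2 * (n * weight n t)     ≡⟨ swap n (weight n t) ⟩
      n * (2 * weight n t + 0) ≡⟨ cong (n *_) 2w≡π₃ ⟩
      n * π₃ (2 * n ∸ 3)       ∎)
  , proj₂ extremal
  where
  open ≡-Reasoning
  t = suc s

  swap : ∀ n w → 2 * (n * w) ≡ n * (2 * w + 0)
  swap = solve-∀

  n/3≡t : n / 3 ≡ t
  n/3≡t = trans (cong (_/ 3) n≡) (third t r r<3)

  peak : ∀ d → weight n d ≤ weight n t × (weight n d ≡ weight n t ⇔ d ≡ n / 3)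
  peak d = subst (λ x → weight n d ≤ weight n t × (weight n d ≡ weight n t ⇔ d ≡ x)) (sym n/3≡t) (weight-peak t
    (subst (3 * t <_) (sym n≡) (ℕ.m<m+n (3 * t) 0<r))
    (subst₂ _<_ (sym n≡) (trans (ℕ.+-comm (3 * t) 3) (sym (ℕ.*-suc 3 t))) (ℕ.+-monoʳ-< (3 * t) r<3))
    (subst (3 + t ≤_) (sym n≡) (peak-room s 0<r)) d)

  extremal = maximal-degrees {Good = _≡ n / 3} (proj₁ ∘ peak) (proj₂ ∘ peak) attained

almost-regular-extremal : ∀ {n} t u → 0 < t → n ≡ 3 * suc t → u ≡ suc t →
  (∃ λ (G : Graph n) → Λ H G ≡ n * weight n t) →
    2 * Λmax H n + n * (1 + 2 * t) ≡ n * π₃ (2 * n ∸ 3)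
  × (∀ (G : Graph n) → (Λ H G ≡ Λmax H n) ⇔ (∀ v → degree G v ≡ t ⊎ degree G v ≡ u))
almost-regular-extremal {n} t u 0<t n≡ u≡ attained =
    (begin
      2 * Λmax H n + n * (1 + 2 * t)          ≡⟨ cong (λ x → 2 * x + n * (1 + 2 * t)) (proj₁ extremal) ⟩
      2 * (n * weight n t) + n * (1 + 2 * t)  ≡⟨ factor n (weight n t) (1 + 2 * t) ⟩
      n * (2 * weight n t + (1 + 2 * t))      ≡⟨ cong (n *_) (twice-weight-3 t n≡) ⟩
      n * π₃ (2 * n ∸ 3)                      ∎)
  , proj₂ extremal
  where
  open ≡-Reasoning

  factor : ∀ n w δ → 2 * (n * w) + n * δ ≡ n * (2 * w + δ)
  factor = solve-∀

  plateau = weight-plateau t u 0<t n≡ u≡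
  extremal = maximal-degrees {Good = λ d → d ≡ t ⊎ d ≡ u} (proj₁ ∘ plateau) (proj₂ ∘ plateau) attained

defect-extremal : ∀ {n} k t u → n ≡ 6 * k + 5 → t ≡ suc (2 * k) → u ≡ suc t →
    2 * (Λmax H n + 2 * t) ≡ n * π₃ (2 * n ∸ 3)
  × (∀ (G : Graph n) → (Λ H G ≡ Λmax H n) ⇔ (#degree≡ G t ≡ n ∸ 1 × #degree≡ G u ≡ 1))
defect-extremal {n} k t u n≡ refl refl = value , λ G → mk⇔
    (λ eq → extremal⇒degrees G (trans (cong (_+ loss) eq) Λmax+loss))
    (λ (C₀ , C₁) → ℕ.+-cancelʳ-≡ loss _ _ (trans (degrees⇒extremal G C₀ C₁) (sym Λmax+loss)))
  where
  loss : ℕ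
  loss = 2 * t

  n≡3t+2 : n ≡ 3 * t + 2
  n≡3t+2 = trans n≡ (size k)
    where
    size : ∀ k → 6 * k + 5 ≡ 3 * suc (2 * k) + 2
    size = solve-∀

  odd : ¬ 2 ∣ n * t
  odd 2∣nt = contradiction
    (∣1⇒≡1 (∣m+n∣m⇒∣n (subst (2 ∣_) (trans (cong (_* t) n≡) (product-odd k)) 2∣nt)
      (m∣m*n (6 * (k * k) + 8 * k + 2)))) λ ()
    where
    product-odd : ∀ k → (6 * k + 5) * suc (2 * k) ≡ 2 * (6 * (k * k) + 8 * k + 2) + 1
    product-odd = solve-∀

  near : weight n t ≡ weight n (suc t) + loss
  near = weight-near-peak (2 * k) n≡3t+2

  open NearPeak {n} {t} {loss} (subst (0 <_) (sym (trans n≡3t+2 (ℕ.+-comm (3 * t) 2))) (s≤s z≤n))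
    near (weight-off-peak (2 * k) n≡3t+2) odd

  M : ℕ
  M = 3 * k + 2

  -- The apex degree 2c is even while t = 2k + 1 is odd; c = k + 1 gives it the degree t + 1.
  built : ∃ λ (G : Graph n) → Λ H G ≡ M * weight n t + (M * weight n t + 1 * weight n (2 * suc k))
  built = construct M t (suc k) 1 (trans n≡ (order k)) (s≤s z≤n)
    (subst (t ≤_) (M-t k) (ℕ.m≤m+n t (suc k))) (subst (suc k ≤_) (M-c k) (ℕ.m≤m+n (suc k) (1 + 2 * k))) (inj₁ refl)
    where
    order : ∀ k → 6 * k + 5 ≡ 3 * k + 2 + (3 * k + 2 + 1)
    order = solve-∀
    M-t : ∀ k → suc (2 * k) + suc k ≡ 3 * k + 2
    M-t = solve-∀
    M-c : ∀ k → suc k + (1 + 2 * k) ≡ 3 * k + 2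
    M-c = solve-∀

  Λ+loss : Λ H (proj₁ built) + loss ≡ n * weight n t
  Λ+loss = begin
    Λ H (proj₁ built) + loss
      ≡⟨ cong (_+ loss) (proj₂ built) ⟩
    M * weight n t + (M * weight n t + 1 * weight n (2 * suc k)) + loss
      ≡⟨ cong (λ d → M * weight n t + (M * weight n t + 1 * weight n d) + loss) (ℕ.*-suc 2 k) ⟩
    M * weight n t + (M * weight n t + 1 * weight n (suc t)) + loss
      ≡⟨ regroup (M * weight n t) (weight n (suc t)) loss ⟩
    M * weight n t + (M * weight n t + (weight n (suc t) + loss))
      ≡⟨ cong (λ w → M * weight n t + (M * weight n t + w)) (sym near) ⟩
    M * weight n t + (M * weight n t + weight n t)
      ≡⟨ total k (weight n t) ⟩
    (6 * k + 5) * weight n t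
      ≡⟨ cong (_* weight n t) (sym n≡) ⟩
    n * weight n t ∎
    where
    open ≡-Reasoning
    regroup : ∀ x w l → x + (x + 1 * w) + l ≡ x + (x + (w + l))
    regroup = solve-∀
    total : ∀ k w → (3 * k + 2) * w + ((3 * k + 2) * w + w) ≡ (6 * k + 5) * w
    total = solve-∀

  -- The maximum is compared with the count of the constructed graph itself, so that `loss` cancels
  -- from both sides.
  Λmax+loss : Λmax H n + loss ≡ n * weight n t
  Λmax+loss = trans (cong (_+ loss) (Λmax-≡ H
    (λ G → ℕ.+-cancelʳ-≤ loss _ _ (subst (Λ H G + loss ≤_) (sym Λ+loss) (Λ-bound G)))
    (proj₁ built , refl))) Λ+loss

  value : 2 * (Λmax H n + loss) ≡ n * π₃ (2 * n ∸ 3)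
  value = begin
    2 * (Λmax H n + loss)    ≡⟨ cong (2 *_) Λmax+loss ⟩
    2 * (n * weight n t)     ≡⟨ swap n (weight n t) ⟩
    n * (2 * weight n t + 0) ≡⟨ cong (n *_) (twice-weight-2 (2 * k) n≡3t+2) ⟩
    n * π₃ (2 * n ∸ 3)       ∎
    where
    open ≡-Reasoning
    swap : ∀ n w → 2 * (n * w) ≡ n * (2 * w + 0)
    swap = solve-∀

lemma3p4 : ∀ (n : ℕ) → n ≥ 4 →
    ( (n % 6 ≡ 1) ⊎ (n % 6 ≡ 2) ⊎ (n % 6 ≡ 4) →
    (+ Λmax H n ÷ 1 ≡ + (n * π₃ (2 * n ∸ 3)) ÷ 2)
    × (∀ (G : Graph n) → (Λ H G ≡ Λmax H n) ⇔ IsRegular G (n / 3)) )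
    × ( ∀ (k : ℕ) → n ≡ 6 * k →
    (+ Λmax H n ÷ 1 ≡ + (n * π₃ (2 * n ∸ 3)) ÷ 2 - + (3 * k * (4 * k ∸ 1)) ÷ 1)
    × (∀ (G : Graph n) → (Λ H G ≡ Λmax H n) ⇔
    (∀ v → (degree G v ≡ 2 * k ∸ 1) ⊎ (degree G v ≡ 2 * k))) )
    × ( ∀ (k : ℕ) → n ≡ 6 * k + 3 →
    (+ Λmax H n ÷ 1 ≡ + (n * π₃ (2 * n ∸ 3)) ÷ 2 - + ((6 * k + 3) * (4 * k + 1)) ÷ 2)
    × (∀ (G : Graph n) → (Λ H G ≡ Λmax H n) ⇔
    (∀ v → (degree G v ≡ 2 * k) ⊎ (degree G v ≡ 2 * k + 1))) )
    × ( ∀ (k : ℕ) → n ≡ 6 * k + 5 →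
    (+ Λmax H n ÷ 1 ≡ + (n * π₃ (2 * n ∸ 3)) ÷ 2 - + (4 * k + 2) ÷ 1)
    × (∀ (G : Graph n) → (Λ H G ≡ Λmax H n) ⇔
    ((#degree≡ G (2 * k + 1) ≡ n ∸ 1) × (#degree≡ G (2 * k + 2) ≡ 1))) )
lemma3p4 n n≥4 = peak , plateau₀ , plateau₃ , defect
  where
  Regular : Set₁
  Regular = (+ Λmax H n ÷ 1 ≡ + (n * π₃ (2 * n ∸ 3)) ÷ 2)
    × (∀ (G : Graph n) → (Λ H G ≡ Λmax H n) ⇔ IsRegular G (n / 3))

  peak : (n % 6 ≡ 1) ⊎ (n % 6 ≡ 2) ⊎ (n % 6 ≡ 4) → Regular
  peak = λ
    { (inj₁ n%6≡1)        → peak₁ (n / 6) (division n%6≡1)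
    ; (inj₂ (inj₁ n%6≡2)) → peak₂ (n / 6) (division n%6≡2)
    ; (inj₂ (inj₂ n%6≡4)) → peak₄ (n / 6) (division n%6≡4) }
    where
    division : ∀ {r} → n % 6 ≡ r → n ≡ r + n / 6 * 6
    division n%6≡r = trans (m≡m%n+[m/n]*n n 6) (cong (_+ n / 6 * 6) n%6≡r)

    peak₁ : ∀ k → n ≡ 1 + k * 6 → Regular
    peak₁ zero    refl = contradiction n≥4 λ { (s≤s ()) }
    peak₁ (suc j) n≡   = regular-extremal s 1 n≡₁ (s≤s z≤n) (s≤s (s≤s z≤n)) (twice-weight-1 s n≡₁)
      (construct-odd (3 * k) (2 * k) k (trans n≡ (order k)) (s≤s z≤n) (ℕ.*-monoˡ-≤ k {2} {3} (s≤s (s≤s z≤n))) (ℕ.m≤n*m k 3) refl)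
      where
      k = suc j
      -- Chosen so that `suc s` reduces to `2 * k`.
      s = j + (k + 0)
      size : ∀ k → 1 + k * 6 ≡ 3 * (2 * k) + 1
      size = solve-∀
      order : ∀ k → 1 + k * 6 ≡ 3 * k + (3 * k + 1)
      order = solve-∀
      n≡₁ : n ≡ 3 * (2 * k) + 1
      n≡₁ = trans n≡ (size k)

    peak₂ : ∀ k → n ≡ 2 + k * 6 → Regular
    peak₂ zero    refl = contradiction n≥4 λ { (s≤s (s≤s ())) }
    peak₂ (suc j) n≡   = regular-extremal s 2 n≡₂ (s≤s z≤n) (s≤s (s≤s (s≤s z≤n))) (twice-weight-2 s n≡₂)
      (construct-even (1 + 3 * k) (2 * k) (trans n≡ (order k)) (s≤s z≤n)
        (ℕ.m≤n⇒m≤1+n (ℕ.*-monoˡ-≤ k {2} {3} (s≤s (s≤s z≤n)))))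
      where
      k = suc j
      s = j + (k + 0)
      size : ∀ k → 2 + k * 6 ≡ 3 * (2 * k) + 2
      size = solve-∀
      order : ∀ k → 2 + k * 6 ≡ 1 + 3 * k + (1 + 3 * k)
      order = solve-∀
      n≡₂ : n ≡ 3 * (2 * k) + 2
      n≡₂ = trans n≡ (size k)

    peak₄ : ∀ k → n ≡ 4 + k * 6 → Regular
    peak₄ k n≡ = regular-extremal (2 * k) 1 n≡₄ (s≤s z≤n) (s≤s (s≤s z≤n)) (twice-weight-1 (2 * k) n≡₄)
      (construct-even (2 + 3 * k) (1 + 2 * k) (trans n≡ (order k)) (s≤s z≤n)
        (s≤s (ℕ.m≤n⇒m≤1+n (ℕ.*-monoˡ-≤ k {2} {3} (s≤s (s≤s z≤n))))))
      where
      size : ∀ k → 4 + k * 6 ≡ 3 * suc (2 * k) + 1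
      size = solve-∀
      order : ∀ k → 4 + k * 6 ≡ 2 + 3 * k + (2 + 3 * k)
      order = solve-∀
      n≡₄ : n ≡ 3 * suc (2 * k) + 1
      n≡₄ = trans n≡ (size k)

  plateau₀ : ∀ k → n ≡ 6 * k → _
  plateau₀ zero    refl = contradiction n≥4 λ ()
  plateau₀ (suc j) n≡   =
    let (value , extremal) = almost-regular-extremal t (2 * k) 0<t (trans n≡ (size j)) refl
          (construct-even (3 * k) t (trans n≡ (order k)) 0<t
            (ℕ.≤-trans (ℕ.n≤1+n t) (ℕ.*-monoˡ-≤ k {2} {3} (s≤s (s≤s z≤n)))))
    in ÷1≡÷2-÷ (Λmax H n) (n * π₃ (2 * n ∸ 3)) (3 * k * (4 * k ∸ 1)) 1 (trans (trans (regroup (Λmax H n) (3 * k * (4 * k ∸ 1)))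
         (cong (λ x → 2 * Λmax H n + x) (trans (loss j) (cong (_* (1 + 2 * t)) (sym n≡))))) (trans value (sym (ℕ.*-identityʳ _))))
     , extremal
    where
    k = suc j
    -- This is what `2 * k ∸ 1` reduces to, so the degree condition has the required form without
    -- rewriting.
    t = j + (k + 0)
    0<t : 0 < t
    0<t = subst (0 <_) (sym (ℕ.+-suc j (j + 0))) (s≤s z≤n)
    size : ∀ j → 6 * suc j ≡ 3 * suc (j + (suc j + 0))
    size = solve-∀
    order : ∀ k → 6 * k ≡ 3 * k + 3 * k
    order = solve-∀
    regroup : ∀ a c → 2 * (a * 1 + c) ≡ 2 * a + 2 * c
    regroup = solve-∀
    loss : ∀ j → 2 * (3 * suc j * (j + (suc j + (suc j + (suc j + 0))))) ≡ 6 * suc j * (1 + 2 * (j + (suc j + 0)))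
    loss = solve-∀

  plateau₃ : ∀ k → n ≡ 6 * k + 3 → _
  plateau₃ zero    refl = contradiction n≥4 λ { (s≤s (s≤s (s≤s ()))) }
  plateau₃ k@(suc _) n≡ =
    let (value , extremal) = almost-regular-extremal (2 * k) (2 * k + 1) (s≤s z≤n) (trans n≡ (size k)) (ℕ.+-comm (2 * k) 1)
          -- Of the two optimal degrees only the even one, 2k, allows a regular graph of odd order.
          (construct-odd (1 + 3 * k) (2 * k) k (trans n≡ (order k)) (s≤s z≤n)
            (ℕ.m≤n⇒m≤1+n (ℕ.*-monoˡ-≤ k {2} {3} (s≤s (s≤s z≤n)))) (ℕ.m≤n⇒m≤1+n (ℕ.m≤n*m k 3)) refl)
    in ÷1≡÷2-÷ (Λmax H n) (n * π₃ (2 * n ∸ 3)) ((6 * k + 3) * (4 * k + 1)) 2 (trans (regroup (Λmax H n) k) (trans (cong (_* 2)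
         (trans (cong (λ x → 2 * Λmax H n + x * (1 + 2 * (2 * k))) (sym n≡)) value)) refl))
     , extremal
    where
    size : ∀ k → 6 * k + 3 ≡ 3 * suc (2 * k)
    size = solve-∀
    order : ∀ k → 6 * k + 3 ≡ 1 + 3 * k + (1 + 3 * k + 1)
    order = solve-∀
    regroup : ∀ a k → 2 * (a * 2 + (6 * k + 3) * (4 * k + 1)) ≡ (2 * a + (6 * k + 3) * (1 + 2 * (2 * k))) * 2
    regroup = solve-∀

  defect : ∀ k → n ≡ 6 * k + 5 → _
  defect k n≡ =
    let (value , extremal) = defect-extremal k (2 * k + 1) (2 * k + 2) n≡ (ℕ.+-comm (2 * k) 1) (ℕ.+-suc (2 * k) 1)
    in ÷1≡÷2-÷ (Λmax H n) (n * π₃ (2 * n ∸ 3)) (4 * k + 2) 1 (trans (regroup (Λmax H n) k) (trans value (sym (ℕ.*-identityʳ _)))) , extremal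
    where
    regroup : ∀ a k → 2 * (a * 1 + (4 * k + 2)) ≡ 2 * (a + 2 * (2 * k + 1))
    regroup = solve-∀
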